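{- There is a real number $C$ with the following property. For every positive integer $k$ there is $n_0$ such that for all $n \geq n_0$, $s(n, \chi_{>k}) \geq \left(1 - C\frac{\log k}{k}\right)\binom{n}{2}$. This holds both when Mini moves first and when Max moves first.
   Context: Let $\mathcal{P}$ be a monotone increasing property of graphs on vertex set $[n]$. An edge $e \in \binom{[n]}{2}\setminus E(G)$ is legal with respect to a graph $G \notin \mathcal{P}$ if $G \cup \{e\} \notin \mathcal{P}$. The saturation game $(n,\mathcal{P})$: starting from the empty graph on $[n]$, two players, Mini and Max, alternately add a legal edge to the current graph $G$. The game ends when no legal edge exists. Max wants to maximize the number of edges of the final graph and Mini wants to minimize it. The score $s(n,\mathcal{P})$ is the number of edges of the final graph under optimal play by both players; it may depend on which player moves first. $\chi_{>k}$ denotes the property of having chromatic number at least $k+1$. $\log$ is the natural logarithm.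
   Formalization: The theorem is stated for k ≥ 2: for k = 1 no edge is legal, so the score is 0, while log 1 = 0 would make the claimed bound equal to binom(n,2); the natural logarithm is replaced by the floor of the base-2 logarithm, which is equivalent up to the constant C. -}

module Defs where

open import Data.Nat using (ℕ; zero; suc; _⊔_; _⊓_; _<?_)
open import Data.Nat.Combinatorics using (_C_)
open import Data.Fin using (Fin; toℕ; _≟_)
open import Data.Fin.Properties as FinP using ()
open import Data.Vec using (Vec; []; _∷_; lookup)
open import Data.List using (List; []; _∷_; length; map; filter; foldr; concatMap; allFin)
open import Data.List.Relation.Unary.All using (All; all?)
open import Data.Product using (Σ; _×_; _,_; ∃; ∃-syntax; proj₁; proj₂)
open import Data.Product.Properties using (≡-dec)
open import Relation.Nullary using (¬_; Dec; yes; no; ¬?)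
open import Relation.Nullary.Decidable using (_×-dec_)
open import Relation.Binary.PropositionalEquality using (_≡_; _≢_)
import Data.List.Membership.DecPropositional as DecMem

-- Graphs on vertex set Fin n (= [n]).
-- An edge {i,j} is represented canonically by the pair (i , j) with i < j.
-- A graph is a list of such canonical pairs (the game only ever adds
-- edges not yet present, so the lists produced are duplicate-free and
-- `length` is the number of edges).

Edge : ℕ → Set
Edge n = Fin n × Fin n

Graph : ℕ → Set
Graph n = List (Edge n)

allPairs : (n : ℕ) → List (Edge n)
allPairs n = filter (λ e → toℕ (proj₁ e) <? toℕ (proj₂ e))
                    (concatMap (λ i → map (λ j → (i , j)) (allFin n)) (allFin n))

Proper : ∀ {n} (k : ℕ) → Graph n → Vec (Fin k) n → Set
Proper k G c = All (λ e → lookup c (proj₁ e) ≢ lookup c (proj₂ e)) G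

Colorable : ∀ {n} (k : ℕ) → Graph n → Set
Colorable {n} k G = ∃[ c ] Proper {n} k G c

ChiGt : ∀ {n} (k : ℕ) → Graph n → Set
ChiGt k G = ¬ Colorable k G

proper? : ∀ {n} k (G : Graph n) (c : Vec (Fin k) n) → Dec (Proper k G c)
proper? k G c = all? (λ e → ¬? (lookup c (proj₁ e) ≟ lookup c (proj₂ e))) G

∃vec? : ∀ {k} n (P : Vec (Fin k) n → Set) → (∀ v → Dec (P v)) → Dec (∃ P)
∃vec? zero P P? with P? []
... | yes p = yes ([] , p)
... | no ¬p = no λ { ([] , p) → ¬p p }
∃vec? {k} (suc n) P P? with FinP.any? {n = k} (λ a → ∃vec? n (λ v → P (a ∷ v)) (λ v → P? (a ∷ v)))
... | yes (a , v , p) = yes (a ∷ v , p)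
... | no ¬q = no λ { (a ∷ v , p) → ¬q (a , v , p) }

colorable? : ∀ {n} k (G : Graph n) → Dec (Colorable k G)
colorable? {n} k G = ∃vec? n (Proper k G) (proper? k G)

chiGt? : ∀ {n} k (G : Graph n) → Dec (ChiGt k G)
chiGt? k G = ¬? (colorable? k G)

_∈E_ : ∀ {n} → Edge n → Graph n → Set
_∈E_ {n} e G = DecMem._∈_ (≡-dec _≟_ _≟_) e G

Legal : ∀ {n} (k : ℕ) → Graph n → Edge n → Set
Legal k G e = (¬ (e ∈E G)) × (¬ ChiGt k (e ∷ G))

legal? : ∀ {n} k (G : Graph n) (e : Edge n) → Dec (Legal k G e)
legal? {n} k G e = ¬? (DecMem._∈?_ (≡-dec _≟_ _≟_) e G) ×-dec ¬? (chiGt? k (e ∷ G))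

legalEdges : ∀ {n} (k : ℕ) → Graph n → List (Edge n)
legalEdges {n} k G = filter (legal? k G) (allPairs n)

data Player : Set where
  Mini Max : Player

other : Player → Player
other Mini = Max
other Max  = Mini

best : Player → ℕ → List ℕ → ℕ
best Max x xs = foldr _⊔_ x xs
best Mini x xs = foldr _⊓_ x xs

-- value of the game from position G with player p to move.
-- The fuel argument bounds the number of remaining moves; since every
-- move adds a new edge among the binom(n,2) pairs, fuel binom(n,2)
-- from the empty graph is never exhausted before the game ends.
value : ∀ {n} (k : ℕ) → ℕ → Player → Graph n → ℕ
value k zero p G = length G
value k (suc f) p G with legalEdges k G
... | [] = length G
... | e ∷ es = best p (value k f (other p) (e ∷ G))
                     (map (λ e′ → value k f (other p) (e′ ∷ G)) es)

score : (n k : ℕ) → Player → ℕ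
score n k first = value {n} k (n C 2) first []

{-# OPTIONS --safe #-}
-- The final graph is complete k-partite, so Max only has to prevent large independent sets.
-- An edge at a vertex u of degree at most k − 2 is always legal, because u can be recoloured.
-- Say that Max serves u when he plays such an edge uv; let m u count the services of u.
--
-- Choice of v: give a set S of more than t vertices, independent so far, the weight
-- ∏_{u ∈ S} λ ^ m u with λ = n / (n − t). Serving u multiplies the weight of the sets through u
-- by λ, and for an average v it destroys a fraction t / n of it; hence for a suitable v the total
-- weight does not grow. So no set S can survive with m u ≥ ck for all u ∈ S, once
-- t ≥ C n log k / k.
--
-- Choice of u: give a vertex of degree d with m services the weight (5/4) ^ d / 4 ^ m (with d
-- capped at k − 2, and weight 0 once it has been served often enough). Serving a heaviest vertex
-- of degree at most k − 2 makes up for what this move and the preceding move of Mini add to the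
-- degrees, so the total weight never exceeds its initial value. Hence all but O(n / k) vertices
-- are served often enough, and every colour class of the final graph has size O(n log k / k).
module Submission where

open import Defs
open import Data.Nat
open import Data.Nat.Combinatorics using (_C_; nC1≡n; nCk+nC[k+1]≡[n+1]C[k+1])
open import Data.Nat.DivMod using (_/_; _%_; m≡m%n+[m/n]*n; m%n<n; m/n*n≤m; m≥n⇒m/n>0; m/n≤m)
open import Data.Nat.Logarithm using (⌊log₂_⌋; ⌊log₂⌋-mono-≤; ⌊log₂[2^n]⌋≡n)
open import Data.Nat.Properties
open import Data.Nat.Tactic.RingSolver using (solve-∀)
open import Algebra.Properties.CommutativeSemigroup +-commutativeSemigroup using (interchange)
open import Algebra.Properties.CommutativeSemigroup *-commutativeSemigroup using (x∙yz≈y∙xz; xy∙z≈xz∙y)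
open import Data.Bool using (Bool; true; false)
import Data.Bool as Bool
open import Data.Empty using (⊥-elim)
open import Data.Fin using (Fin; zero; suc; toℕ)
import Data.Fin as Fin
open import Data.Fin.Properties using (¬∀⟶∃¬; toℕ-injective)
open import Data.List using (List; []; _∷_; _++_; map; length; allFin; concatMap)
import Data.List as List
open import Data.List.Membership.Propositional using (_∈_; _∉_; lose)
open import Data.List.Membership.Propositional.Properties using (∈-++⁺ˡ; ∈-++⁺ʳ; ∈-map⁺; ∈-allFin; ∈-filter⁺; ∈-filter⁻; ∈-concatMap⁺)
open import Data.List.Properties using (map-tabulate; length-tabulate; length-++; length-map)
open import Data.List.Relation.Unary.All using (All; []; _∷_)
import Data.List.Relation.Unary.All as All
import Data.List.Relation.Unary.All.Properties as All
open import Data.List.Relation.Unary.Any using (here; there)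
import Data.List.Relation.Unary.Any as Any
open import Data.List.Relation.Unary.Any.Properties using (¬Any[])
open import Data.Product using (∃-syntax; _×_; _,_; proj₁; proj₂)
open import Data.Product.Properties using (≡-dec)
open import Data.Sum using (_⊎_; inj₁; inj₂)
open import Data.Vec using (Vec; []; _∷_; lookup; replicate; tabulate; _[_]≔_; _[_]%=_)
open import Data.Vec.Properties using (lookup∘update; lookup∘update′; lookup∘updateAt; lookup∘updateAt′; lookup∘tabulate; lookup-replicate)
open import Function using (_∘_)
open import Relation.Binary using (tri<; tri≈; tri>)
open import Relation.Binary.PropositionalEquality
open import Relation.Nullary using (¬_; Dec; yes; no; ¬?; does)
open import Relation.Nullary.Decidable using (_×-dec_; dec-true; decidable-stable; toWitness)

private variable
  A B P Q : Set
  n : ℕ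

-- Finite sums

∑ : List A → (A → ℕ) → ℕ
∑ []       f = 0
∑ (x ∷ xs) f = f x + ∑ xs f

∑-mono : {f g : A → ℕ} (xs : List A) → (∀ x → f x ≤ g x) → ∑ xs f ≤ ∑ xs g
∑-mono []       le = z≤n
∑-mono (x ∷ xs) le = +-mono-≤ (le x) (∑-mono xs le)

∑-cong : {f g : A → ℕ} (xs : List A) → (∀ x → f x ≡ g x) → ∑ xs f ≡ ∑ xs g
∑-cong []       eq = refl
∑-cong (x ∷ xs) eq = cong₂ _+_ (eq x) (∑-cong xs eq)

∑-+ : (xs : List A) (f g : A → ℕ) → ∑ xs (λ x → f x + g x) ≡ ∑ xs f + ∑ xs g
∑-+ []       f g = refl
∑-+ (x ∷ xs) f g rewrite ∑-+ xs f g = interchange (f x) (g x) (∑ xs f) (∑ xs g)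

∑-* : (xs : List A) (c : ℕ) (f : A → ℕ) → ∑ xs (λ x → c * f x) ≡ c * ∑ xs f
∑-* []       c f = sym (*-zeroʳ c)
∑-* (x ∷ xs) c f rewrite ∑-* xs c f = sym (*-distribˡ-+ c (f x) (∑ xs f))

∑-*ʳ : (xs : List A) (c : ℕ) (f : A → ℕ) → ∑ xs (λ x → f x * c) ≡ ∑ xs f * c
∑-*ʳ []       c f = refl
∑-*ʳ (x ∷ xs) c f rewrite ∑-*ʳ xs c f = sym (*-distribʳ-+ c (f x) (∑ xs f))

∑-zero : (xs : List A) → ∑ xs (λ _ → 0) ≡ 0
∑-zero []       = refl
∑-zero (x ∷ xs) = ∑-zero xs

∑-const : (xs : List A) (c : ℕ) → ∑ xs (λ _ → c) ≡ length xs * c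
∑-const []       c = refl
∑-const (x ∷ xs) c = cong (c +_) (∑-const xs c)

∑-swap : (xs : List A) (ys : List B) (f : A → B → ℕ) →
  ∑ xs (λ x → ∑ ys (f x)) ≡ ∑ ys (λ y → ∑ xs (λ x → f x y))
∑-swap []       ys f = sym (∑-zero ys)
∑-swap (x ∷ xs) ys f rewrite ∑-swap xs ys f = sym (∑-+ ys (f x) (λ y → ∑ xs (λ x′ → f x′ y)))

∑-∈ : {x : A} {xs : List A} (f : A → ℕ) → x ∈ xs → f x ≤ ∑ xs f
∑-∈ f (here refl) = m≤m+n _ _
∑-∈ f (there x∈)  = ≤-trans (∑-∈ f x∈) (m≤n+m _ _)

∑-++ : (xs ys : List A) (f : A → ℕ) → ∑ (xs ++ ys) f ≡ ∑ xs f + ∑ ys f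
∑-++ []       ys f = refl
∑-++ (x ∷ xs) ys f rewrite ∑-++ xs ys f = sym (+-assoc (f x) (∑ xs f) (∑ ys f))

∑-map : (g : A → B) (xs : List A) (f : B → ℕ) → ∑ (map g xs) f ≡ ∑ xs (f ∘ g)
∑-map g []       f = refl
∑-map g (x ∷ xs) f = cong (f (g x) +_) (∑-map g xs f)

-- The averaging principle: a head with `f x > g x` can be cancelled from both sums without breaking
-- the inequality.
∑-≤⇒∃ : (xs : List A) (f g : A → ℕ) → 0 < length xs → ∑ xs f ≤ ∑ xs g → ∃[ x ] f x ≤ g x
∑-≤⇒∃ (x ∷ xs) f g _ le with f x ≤? g x
... | yes fx≤gx = x , fx≤gx
∑-≤⇒∃ (x ∷ []) f g _ le | no fx≰gx =
  ⊥-elim (fx≰gx (subst₂ _≤_ (+-identityʳ (f x)) (+-identityʳ (g x)) le))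
∑-≤⇒∃ (x ∷ xs@(_ ∷ _)) f g _ le | no fx≰gx = ∑-≤⇒∃ xs f g (s≤s z≤n)
  (+-cancelˡ-≤ (g x) _ _ (≤-trans (+-monoˡ-≤ (∑ xs f) (<⇒≤ (≰⇒> fx≰gx))) le))

∑-pos⇒∃ : (xs : List A) (f : A → ℕ) → 0 < ∑ xs f → ∃[ x ] 0 < f x
∑-pos⇒∃ (x ∷ xs) f pos with f x in eq
... | zero  = ∑-pos⇒∃ xs f pos
... | suc a = x , subst (0 <_) (sym eq) (s≤s z≤n)

∑-allFin-suc : (f : Fin (suc n) → ℕ) →
  ∑ (allFin (suc n)) f ≡ f zero + ∑ (allFin n) (f ∘ suc)
∑-allFin-suc {n} f = cong (f zero +_) (begin
  ∑ (List.tabulate suc) f      ≡⟨ cong (λ xs → ∑ xs f) (sym (map-tabulate (λ i → i) suc)) ⟩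
  ∑ (map suc (allFin n)) f ≡⟨ ∑-map suc (allFin n) f ⟩
  ∑ (allFin n) (f ∘ suc)  ∎)
  where open ≡-Reasoning

𝟙 : Dec P → ℕ
𝟙 (yes _) = 1
𝟙 (no  _) = 0

𝟙-mono : (P? : Dec P) (Q? : Dec Q) → (P → Q) → 𝟙 P? ≤ 𝟙 Q?
𝟙-mono (yes p) (yes q) f = ≤-refl
𝟙-mono (yes p) (no ¬q) f = ⊥-elim (¬q (f p))
𝟙-mono (no ¬p) Q?      f = z≤n

𝟙≤1 : (P? : Dec P) → 𝟙 P? ≤ 1
𝟙≤1 (yes _) = ≤-refl
𝟙≤1 (no  _) = z≤n

𝟙-yes : (P? : Dec P) → P → 𝟙 P? ≡ 1
𝟙-yes (yes _) p = refl
𝟙-yes (no ¬p) p = ⊥-elim (¬p p)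

δ : Fin n → Fin n → ℕ
δ i j = 𝟙 (i Fin.≟ j)

δ-refl : (i : Fin n) → δ i i ≡ 1
δ-refl i = 𝟙-yes (i Fin.≟ i) refl

δ-suc : (i j : Fin n) → δ (suc i) (suc j) ≡ δ i j
δ-suc i j with i Fin.≟ j
... | yes _ = refl
... | no  _ = refl

∑-δ : (j : Fin n) → ∑ (allFin n) (λ i → δ i j) ≡ 1
∑-δ {suc n} zero = trans (∑-allFin-suc {n} (λ i → δ i zero)) (cong suc (∑-zero (allFin n)))
∑-δ {suc n} (suc j) = trans (∑-allFin-suc (λ i → δ i (suc j)))
  (trans (∑-cong (allFin n) (λ i → δ-suc i j)) (∑-δ j))

∑-δ* : (j : Fin n) (c : ℕ) → ∑ (allFin n) (λ i → δ i j * c) ≡ c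
∑-δ* {n} j c = trans (∑-*ʳ (allFin n) c (λ i → δ i j)) (trans (cong (_* c) (∑-δ j)) (+-identityʳ c))

length-allFin : ∀ n → length (allFin n) ≡ n
length-allFin n = length-tabulate (λ i → i)

_∈?_ : (i : Fin n) (xs : List (Fin n)) → Dec (i ∈ xs)
i ∈? xs = Any.any? (i Fin.≟_) xs

-- Otherwise every i contributes at least 1 to ∑ᵢ #{occurrences of i in xs} = length xs.
missing : (xs : List (Fin n)) → length xs < n → ∃[ i ] i ∉ xs
missing {n} xs lt = ¬∀⟶∃¬ n (_∈ xs) (_∈? xs) λ all → <⇒≱ lt (begin
  n                              ≡⟨ sym (trans (∑-const (allFin n) 1) (trans (*-identityʳ _) (length-allFin n))) ⟩
  ∑ (allFin n) (λ _ → 1)         ≤⟨ ∑-mono (allFin n) (λ i → ≤-trans (≤-reflexive (sym (δ-refl i))) (∑-∈ (δ i) (all i))) ⟩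
  ∑ (allFin n) (λ i → ∑ xs (δ i)) ≡⟨ ∑-swap (allFin n) xs δ ⟩
  ∑ xs (λ j → ∑ (allFin n) (λ i → δ i j)) ≡⟨ ∑-cong xs ∑-δ ⟩
  ∑ xs (λ _ → 1)                 ≡⟨ trans (∑-const xs 1) (*-identityʳ _) ⟩
  length xs                      ∎)
  where open ≤-Reasoning

-- Graphs and legal moves

Canonical : Graph n → Set
Canonical = All (λ e → toℕ (proj₁ e) < toℕ (proj₂ e))

edge : Fin n → Fin n → Edge n
edge u v with toℕ u <? toℕ v
... | yes _ = u , v
... | no  _ = v , u

edge-ends : (u v : Fin n) → edge u v ≡ (u , v) ⊎ edge u v ≡ (v , u)
edge-ends u v with toℕ u <? toℕ v
... | yes _ = inj₁ refl
... | no  _ = inj₂ refl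

edge-canonical : {u v : Fin n} → u ≢ v → toℕ (proj₁ (edge u v)) < toℕ (proj₂ (edge u v))
edge-canonical {u = u} {v} u≢v with toℕ u <? toℕ v
... | yes u<v = u<v
... | no  u≮v = ≤∧≢⇒< (≮⇒≥ u≮v) (u≢v ∘ toℕ-injective ∘ sym)

canonical⇒≢ : {i j : Fin n} → toℕ i < toℕ j → i ≢ j
canonical⇒≢ i<j refl = <-irrefl refl i<j

keep : Dec P → A → List A
keep (yes _) x = x ∷ []
keep (no  _) x = []

length-keep : (P? : Dec P) (x : A) → length (keep P? x) ≡ 𝟙 P?
length-keep (yes _) x = refl
length-keep (no  _) x = refl

-- Neighbours are listed with multiplicity, so that `deg` grows by exactly `δ u i + δ u j` with each
-- added pair, whatever the list contains.
nbrs : Graph n → Fin n → List (Fin n)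
nbrs []            u = []
nbrs ((i , j) ∷ G) u = keep (u Fin.≟ i) j ++ keep (u Fin.≟ j) i ++ nbrs G u

deg : Graph n → Fin n → ℕ
deg G u = length (nbrs G u)

deg-∷ : (i j : Fin n) (G : Graph n) (u : Fin n) →
  deg ((i , j) ∷ G) u ≡ (δ u i + δ u j) + deg G u
deg-∷ i j G u
  rewrite length-++ (keep (u Fin.≟ i) j) {keep (u Fin.≟ j) i ++ nbrs G u}
        | length-++ (keep (u Fin.≟ j) i) {nbrs G u}
        | length-keep (u Fin.≟ i) j | length-keep (u Fin.≟ j) i
        = sym (+-assoc (δ u i) (δ u j) (deg G u))

deg-edge : (u v : Fin n) (G : Graph n) (z : Fin n) →
  deg (edge u v ∷ G) z ≡ (δ z u + δ z v) + deg G z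
deg-edge u v G z with edge-ends u v
... | inj₁ eq rewrite eq = deg-∷ u v G z
... | inj₂ eq rewrite eq = trans (deg-∷ v u G z) (cong (_+ deg G z) (+-comm (δ z v) (δ z u)))

keep-∈ : (P? : Dec P) {x : A} → P → x ∈ keep P? x
keep-∈ (yes _) p = here refl
keep-∈ (no ¬p) p = ⊥-elim (¬p p)

∈-nbrsˡ : {u j : Fin n} (G : Graph n) → (u , j) ∈ G → j ∈ nbrs G u
∈-nbrsˡ {u = u} ((i , j) ∷ G) (here refl) = ∈-++⁺ˡ (keep-∈ (u Fin.≟ i) refl)
∈-nbrsˡ {u = u} ((i , j) ∷ G) (there e∈G) =
  ∈-++⁺ʳ (keep (u Fin.≟ i) j) (∈-++⁺ʳ (keep (u Fin.≟ j) i) (∈-nbrsˡ G e∈G))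

∈-nbrsʳ : {u j : Fin n} (G : Graph n) → (j , u) ∈ G → j ∈ nbrs G u
∈-nbrsʳ {u = u} ((i , j) ∷ G) (here refl) =
  ∈-++⁺ʳ (keep (u Fin.≟ i) j) (∈-++⁺ˡ (keep-∈ (u Fin.≟ j) refl))
∈-nbrsʳ {u = u} ((i , j) ∷ G) (there e∈G) =
  ∈-++⁺ʳ (keep (u Fin.≟ i) j) (∈-++⁺ʳ (keep (u Fin.≟ j) i) (∈-nbrsʳ G e∈G))

-- Stated for any two distinct vertices, so that it covers the new edge in either orientation as
-- well as the old edges at `u` and away from it.
recolour-≢ : {k : ℕ} (c : Vec (Fin k) n) (u : Fin n) (x : Fin k) {i j : Fin n} → i ≢ j →
  (i ≡ u → x ≢ lookup c j) → (j ≡ u → x ≢ lookup c i) →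
  (i ≢ u → j ≢ u → lookup c i ≢ lookup c j) →
  lookup (c [ u ]≔ x) i ≢ lookup (c [ u ]≔ x) j
recolour-≢ c u x {i} {j} i≢j p q r with i Fin.≟ u | j Fin.≟ u
... | yes refl | yes refl = ⊥-elim (i≢j refl)
... | yes refl | no  j≢u rewrite lookup∘update i c x | lookup∘update′ j≢u c x = p refl
... | no  i≢u | yes refl rewrite lookup∘update j c x | lookup∘update′ i≢u c x = q refl ∘ sym
... | no  i≢u | no  j≢u rewrite lookup∘update′ i≢u c x | lookup∘update′ j≢u c x = r i≢u j≢u

-- Some colour is missing from the neighbours of u and from v, so u can be recoloured.
colorable-edge : {k : ℕ} {G : Graph n} {u v : Fin n} → Canonical G → Colorable k G → suc (deg G u) < k →
  u ≢ v → Colorable k (edge u v ∷ G)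
colorable-edge {n} {k} {G} {u} {v} can (c , proper) d<k u≢v with
  missing (lookup c v ∷ map (lookup c) (nbrs G u))
    (subst (λ d → suc d < k) (sym (length-map (lookup c) (nbrs G u))) d<k)
... | x , x∉ = c [ u ]≔ x , new ∷ All.tabulate old
  where
  new : lookup (c [ u ]≔ x) (proj₁ (edge u v)) ≢ lookup (c [ u ]≔ x) (proj₂ (edge u v))
  new with edge-ends u v
  ... | inj₁ eq rewrite eq = recolour-≢ c u x u≢v (λ _ → x∉ ∘ here) (λ v≡u → ⊥-elim (u≢v (sym v≡u))) (λ u≢u → ⊥-elim (u≢u refl))
  ... | inj₂ eq rewrite eq = recolour-≢ c u x (u≢v ∘ sym) (λ v≡u → ⊥-elim (u≢v (sym v≡u))) (λ _ → x∉ ∘ here) (λ _ u≢u → ⊥-elim (u≢u refl))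
  old : ∀ {e} → e ∈ G → lookup (c [ u ]≔ x) (proj₁ e) ≢ lookup (c [ u ]≔ x) (proj₂ e)
  old {i , j} e∈G = recolour-≢ c u x (canonical⇒≢ (All.lookup can e∈G))
    (λ { refl eq → x∉ (there (subst (_∈ _) (sym eq) (∈-map⁺ (lookup c) (∈-nbrsˡ G e∈G)))) })
    (λ { refl eq → x∉ (there (subst (_∈ _) (sym eq) (∈-map⁺ (lookup c) (∈-nbrsʳ G e∈G)))) })
    (λ _ _ → All.lookup proper e∈G)

non-neighbour : (G : Graph n) (u : Fin n) → suc (deg G u) < n → ∃[ v ] u ≢ v × edge u v ∉ G
non-neighbour G u d<n with missing (u ∷ nbrs G u) d<n
... | v , v∉ = v , (λ u≡v → v∉ (here (sym u≡v))) , λ e∈G → v∉ (there (nbr e∈G))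
  where
  nbr : edge u v ∈ G → v ∈ nbrs G u
  nbr e∈G with edge-ends u v
  ... | inj₁ eq = ∈-nbrsˡ G (subst (_∈ G) eq e∈G)
  ... | inj₂ eq = ∈-nbrsʳ G (subst (_∈ G) eq e∈G)

∈-allPairs : {e : Edge n} → toℕ (proj₁ e) < toℕ (proj₂ e) → e ∈ allPairs n
∈-allPairs {n} {i , j} i<j = ∈-filter⁺ (λ e → toℕ (proj₁ e) <? toℕ (proj₂ e))
  (∈-concatMap⁺ (λ i → map (i ,_) (allFin n)) (lose (∈-allFin i) (∈-map⁺ (i ,_) (∈-allFin j)))) i<j

∈-legalEdges⁺ : {k : ℕ} {G : Graph n} {e : Edge n} → toℕ (proj₁ e) < toℕ (proj₂ e) → e ∉ G →
  Colorable k (e ∷ G) → e ∈ legalEdges k G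
∈-legalEdges⁺ {n} {k} {G} i<j e∉G col =
  ∈-filter⁺ (legal? k G) (∈-allPairs i<j) (e∉G , λ χ> → χ> col)

∈-legalEdges⁻ : {k : ℕ} {G : Graph n} {e : Edge n} → e ∈ legalEdges k G →
  toℕ (proj₁ e) < toℕ (proj₂ e) × Colorable k (e ∷ G)
∈-legalEdges⁻ {n} {k} {G} {e} e∈ with ∈-filter⁻ (legal? k G) {xs = allPairs n} e∈
... | e∈all , _ , ¬χ> = proj₂ (∈-filter⁻ (λ e → toℕ (proj₁ e) <? toℕ (proj₂ e))
        {xs = concatMap (λ i → map (i ,_) (allFin n)) (allFin n)} e∈all)
      , decidable-stable (colorable? k (e ∷ G)) ¬χ>

_∈ᴱ?_ : (e : Edge n) (G : Graph n) → Dec (e ∈ G)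
e ∈ᴱ? G = Any.any? (≡-dec Fin._≟_ Fin._≟_ e) G

-- Edge count of a saturated graph, by ordered pairs of vertices

∑∑ : ∀ n → (Fin n → Fin n → ℕ) → ℕ
∑∑ n f = ∑ (allFin n) (λ i → ∑ (allFin n) (f i))

-- A pair that occurs repeatedly in the list counts once on the left, hence only an inequality.
∑-∈-≤-length : (G : Graph n) → ∑∑ n (λ i j → 𝟙 ((i , j) ∈ᴱ? G)) ≤ length G
∑-∈-≤-length {n} [] = ≤-reflexive (trans (∑-cong (allFin n) (λ _ → ∑-zero (allFin n))) (∑-zero (allFin n)))
∑-∈-≤-length {n} (e@(a , b) ∷ G) = begin
  ∑∑ n (λ i j → 𝟙 ((i , j) ∈ᴱ? (e ∷ G)))
    ≤⟨ ∑-mono (allFin n) (λ i → ∑-mono (allFin n) (pointwise i)) ⟩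
  ∑∑ n (λ i j → δ j b * δ i a + 𝟙 ((i , j) ∈ᴱ? G))
    ≡⟨ ∑-cong (allFin n) (λ i → trans (∑-+ (allFin n) _ _) (cong (_+ _) (∑-δ* b (δ i a)))) ⟩
  ∑ (allFin n) (λ i → δ i a + ∑ (allFin n) (λ j → 𝟙 ((i , j) ∈ᴱ? G)))
    ≡⟨ trans (∑-+ (allFin n) _ _) (cong (_+ _) (∑-δ a)) ⟩
  suc (∑∑ n (λ i j → 𝟙 ((i , j) ∈ᴱ? G)))
    ≤⟨ s≤s (∑-∈-≤-length G) ⟩
  suc (length G) ∎
  where
  open ≤-Reasoning
  pointwise : ∀ i j → 𝟙 ((i , j) ∈ᴱ? (e ∷ G)) ≤ δ j b * δ i a + 𝟙 ((i , j) ∈ᴱ? G)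
  pointwise i j with (i , j) ∈ᴱ? (e ∷ G)
  ... | no _ = z≤n
  ... | yes (here refl) rewrite δ-refl i | δ-refl j = s≤s z≤n
  ... | yes (there ij∈G) rewrite 𝟙-yes ((i , j) ∈ᴱ? G) ij∈G = m≤n+m 1 _

2*nC2+n≡n² : ∀ n → 2 * (n C 2) + n ≡ n * n
2*nC2+n≡n² zero    = refl
2*nC2+n≡n² (suc n) = begin
  2 * (suc n C 2) + suc n     ≡⟨ cong (λ x → 2 * x + suc n) (sym (nCk+nC[k+1]≡[n+1]C[k+1] n 1)) ⟩
  2 * (n C 1 + n C 2) + suc n ≡⟨ cong (λ x → 2 * (x + n C 2) + suc n) (nC1≡n n) ⟩
  2 * (n + n C 2) + suc n     ≡⟨ rearrange n (n C 2) ⟩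
  (2 * (n C 2) + n) + (2 * n + 1) ≡⟨ cong (_+ (2 * n + 1)) (2*nC2+n≡n² n) ⟩
  n * n + (2 * n + 1)         ≡⟨ square n ⟩
  suc n * suc n               ∎
  where
  open ≡-Reasoning
  rearrange : ∀ n c → 2 * (n + c) + suc n ≡ (2 * c + n) + (2 * n + 1)
  rearrange = solve-∀
  square : ∀ n → n * n + (2 * n + 1) ≡ suc n * suc n
  square = solve-∀

∑∑-1 : ∀ n → ∑∑ n (λ _ _ → 1) ≡ n * n
∑∑-1 n = begin
  ∑∑ n (λ _ _ → 1)            ≡⟨ ∑-cong (allFin n) (λ _ → trans (∑-const (allFin n) 1) (trans (*-identityʳ _) (length-allFin n))) ⟩
  ∑ (allFin n) (λ _ → n)      ≡⟨ ∑-const (allFin n) n ⟩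
  length (allFin n) * n       ≡⟨ cong (_* n) (length-allFin n) ⟩
  n * n                       ∎
  where open ≡-Reasoning

-- Each ordered pair is an edge in one of its two orientations or lies within a colour class. The
-- diagonal is in the classes too: it accounts for the one in `suc a` and for the `n` in
-- `n * n = 2 * (n C 2) + n`.
saturated-size : {k : ℕ} (G : Graph n) (c : Vec (Fin k) n) (a : ℕ) →
  (∀ i j → toℕ i < toℕ j → lookup c i ≢ lookup c j → (i , j) ∈ G) →
  (∀ i → ∑ (allFin n) (λ j → 𝟙 (lookup c i Fin.≟ lookup c j)) ≤ suc a) →
  2 * (n C 2) ≤ 2 * length G + n * a
saturated-size {n} G c a sat class≤ = +-cancelʳ-≤ n _ _ (begin
  2 * (n C 2) + n  ≡⟨ trans (2*nC2+n≡n² n) (sym (∑∑-1 n)) ⟩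
  ∑∑ n (λ _ _ → 1) ≤⟨ ∑-mono (allFin n) (λ i → ∑-mono (allFin n) (pointwise i)) ⟩
  ∑∑ n (λ i j → (g i j + g j i) + same i j)
    ≡⟨ ∑-cong (allFin n) (λ i → trans (∑-+ (allFin n) _ _) (cong (_+ ∑ (allFin n) (same i)) (∑-+ (allFin n) _ _))) ⟩
  ∑ (allFin n) (λ i → (∑ (allFin n) (g i) + ∑ (allFin n) (λ j → g j i)) + ∑ (allFin n) (same i))
    ≡⟨ trans (∑-+ (allFin n) _ _) (cong (_+ ∑∑ n same) (∑-+ (allFin n) _ _)) ⟩
  (∑∑ n g + ∑∑ n (λ i j → g j i)) + ∑∑ n same
    ≡⟨ cong (λ x → (∑∑ n g + x) + ∑∑ n same) (∑-swap (allFin n) (allFin n) (λ i j → g j i)) ⟩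
  (∑∑ n g + ∑∑ n g) + ∑∑ n same
    ≤⟨ +-mono-≤ (+-mono-≤ (∑-∈-≤-length G) (∑-∈-≤-length G)) (∑-mono (allFin n) class≤) ⟩
  (length G + length G) + ∑ (allFin n) (λ _ → suc a)
    ≡⟨ cong ((length G + length G) +_) (trans (∑-const (allFin n) (suc a)) (cong (_* suc a) (length-allFin n))) ⟩
  (length G + length G) + n * suc a ≡⟨ rearrange (length G) n a ⟩
  (2 * length G + n * a) + n ∎)
  where
  open ≤-Reasoning
  g same : Fin n → Fin n → ℕ
  g i j = 𝟙 ((i , j) ∈ᴱ? G)
  same i j = 𝟙 (lookup c i Fin.≟ lookup c j)
  rearrange : ∀ l n a → (l + l) + n * suc a ≡ (2 * l + n * a) + n
  rearrange = solve-∀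
  pointwise : ∀ i j → 1 ≤ (g i j + g j i) + same i j
  pointwise i j with lookup c i Fin.≟ lookup c j
  ... | yes _ = m≤n+m 1 _
  ... | no ci≢cj with <-cmp (toℕ i) (toℕ j)
  ...   | tri< i<j _ _ rewrite 𝟙-yes ((i , j) ∈ᴱ? G) (sat i j i<j ci≢cj) = s≤s z≤n
  ...   | tri≈ _ i≡j _ = ⊥-elim (ci≢cj (cong (lookup c) (toℕ-injective i≡j)))
  ...   | tri> _ _ j<i rewrite 𝟙-yes ((j , i) ∈ᴱ? G) (sat j i j<i (ci≢cj ∘ sym)) = ≤-trans (m≤n+m 1 (g i j)) (m≤m+n _ 0)

-- Potential of the independent sets

_∋_ : Vec Bool n → Fin n → Set
S ∋ u = lookup S u ≡ true

_∋?_ : (S : Vec Bool n) (u : Fin n) → Dec (S ∋ u)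
S ∋? u = lookup S u Bool.≟ true

card : Vec Bool n → ℕ
card {n} S = ∑ (allFin n) (λ u → 𝟙 (S ∋? u))

subsets : ∀ n → List (Vec Bool n)
subsets zero    = [] ∷ []
subsets (suc n) = map (true ∷_) (subsets n) ++ map (false ∷_) (subsets n)

∈-subsets : (S : Vec Bool n) → S ∈ subsets n
∈-subsets []                  = here refl
∈-subsets {suc n} (true ∷ S)  = ∈-++⁺ˡ (∈-map⁺ (true ∷_) (∈-subsets S))
∈-subsets {suc n} (false ∷ S) = ∈-++⁺ʳ (map (true ∷_) (subsets n)) (∈-map⁺ (false ∷_) (∈-subsets S))

Indep : Graph n → Vec Bool n → Set
Indep G S = All (λ e → ¬ (S ∋ proj₁ e × S ∋ proj₂ e)) G

indep? : (G : Graph n) (S : Vec Bool n) → Dec (Indep G S)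
indep? G S = All.all? (λ e → ¬? ((S ∋? proj₁ e) ×-dec (S ∋? proj₂ e))) G

indep-edge : {G : Graph n} (S : Vec Bool n) {u v : Fin n} → edge u v ∈ G → Indep G S →
  ¬ (S ∋ u × S ∋ v)
indep-edge S {u} {v} e∈G ind (u∈S , v∈S) with edge-ends u v | All.lookup ind e∈G
... | inj₁ eq | ¬both rewrite eq = ¬both (u∈S , v∈S)
... | inj₂ eq | ¬both rewrite eq = ¬both (v∈S , u∈S)

module Weight (p b q : ℕ) where

  -- With p = n and q = n − t, this is the weight ∏_{u ∈ S} (p / q) ^ m u, multiplied by q ^ sum m
  -- and by b ^ |V ∖ S|; the latter makes the initial total (b + 1) ^ n.
  W : Vec ℕ n → Vec Bool n → ℕ
  W []       []          = 1
  W (a ∷ m) (true ∷ S)  = p ^ a * W m S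
  W (a ∷ m) (false ∷ S) = (b * q ^ a) * W m S

  factor : Bool → ℕ
  factor true  = p
  factor false = q

  -- The intended factors are `p / q` on the sets through `u` and 1 on the others; the common
  -- multiple `q` keeps them integral.
  W-serve : (m : Vec ℕ n) (S : Vec Bool n) (u : Fin n) →
    W (m [ u ]%= suc) S ≡ factor (lookup S u) * W m S
  W-serve (a ∷ m) (true ∷ S)  zero = *-assoc p (p ^ a) (W m S)
  W-serve (a ∷ m) (false ∷ S) zero = eq b q (q ^ a) (W m S)
    where
    eq : ∀ b q x w → (b * (q * x)) * w ≡ q * ((b * x) * w)
    eq = solve-∀
  W-serve (a ∷ m) (true ∷ S)  (suc u) rewrite W-serve m S u = x∙yz≈y∙xz (p ^ a) (factor (lookup S u)) (W m S)
  W-serve (a ∷ m) (false ∷ S) (suc u) rewrite W-serve m S u = x∙yz≈y∙xz (b * q ^ a) (factor (lookup S u)) (W m S)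

  -- The weight of the empty set carries the whole normalisation, so weights are measured against
  -- `W m ∅`.
  ∅ : Vec Bool n
  ∅ = replicate _ false

  W-zeros-∅ : ∀ n → W (replicate n 0) ∅ ≡ b ^ n
  W-zeros-∅ zero    = refl
  W-zeros-∅ (suc n) = cong₂ _*_ (*-identityʳ b) (W-zeros-∅ n)

  ∑-W-zeros : ∀ n → ∑ (subsets n) (W (replicate n 0)) ≡ suc b ^ n
  ∑-W-zeros zero    = refl
  ∑-W-zeros (suc n)
    rewrite ∑-++ (map (true ∷_) (subsets n)) (map (false ∷_) (subsets n)) (W (replicate (suc n) 0))
          | ∑-map (true ∷_) (subsets n) (W (replicate (suc n) 0))
          | ∑-map (false ∷_) (subsets n) (W (replicate (suc n) 0))
          | ∑-* (subsets n) 1 (W (replicate n 0))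
          | ∑-* (subsets n) (b * 1) (W (replicate n 0))
          | ∑-W-zeros n
          = cong₂ _+_ (*-identityˡ (suc b ^ n)) (cong (_* suc b ^ n) (*-identityʳ b))

  W-∅-pos : 0 < b → 0 < q → (m : Vec ℕ n) → 0 < W m ∅
  W-∅-pos b>0 q>0 []      = s≤s z≤n
  W-∅-pos b>0 q>0 (a ∷ m) = *-mono-≤ (*-mono-≤ b>0 (m^n>0 q {{>-nonZero q>0}} a)) (W-∅-pos b>0 q>0 m)

  -- A member of `S` contributes `p ^ a` in place of `b * q ^ a`, a gain of at least 4; a non-member
  -- contributes the same to both sides.
  W-large : (m : Vec ℕ n) (S : Vec Bool n) →
    (∀ u → S ∋ u → 4 * (b * q ^ lookup m u) ≤ p ^ lookup m u) → 4 ^ card S * W m ∅ ≤ W m S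
  W-large [] [] h = ≤-refl
  W-large (a ∷ m) (x ∷ S) h rewrite ∑-allFin-suc (λ u → 𝟙 ((x ∷ S) ∋? u)) with x
  ... | true  = begin
    (4 * 4 ^ card S) * ((b * q ^ a) * W m ∅) ≡⟨ eq (4 ^ card S) (b * q ^ a) (W m ∅) ⟩
    (4 * (b * q ^ a)) * (4 ^ card S * W m ∅) ≤⟨ *-mono-≤ (h zero refl) (W-large m S (h ∘ suc)) ⟩
    p ^ a * W m S ∎
    where
    open ≤-Reasoning
    eq : ∀ x y z → (4 * x) * (y * z) ≡ (4 * y) * (x * z)
    eq = solve-∀
  ... | false = begin
    4 ^ card S * ((b * q ^ a) * W m ∅) ≡⟨ x∙yz≈y∙xz (4 ^ card S) (b * q ^ a) (W m ∅) ⟩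
    (b * q ^ a) * (4 ^ card S * W m ∅) ≤⟨ *-monoʳ-≤ (b * q ^ a) (W-large m S (h ∘ suc)) ⟩
    (b * q ^ a) * W m S ∎
    where open ≤-Reasoning

module IndepPotential (n b q t : ℕ) (n≤t+q : n ≤ t + q) where

  open Weight n b q public

  Live : Graph n → Vec Bool n → Set
  Live G S = Indep G S × t < card S

  live? : (G : Graph n) (S : Vec Bool n) → Dec (Live G S)
  live? G S = indep? G S ×-dec (t <? card S)

  φ : Graph n → Vec ℕ n → Vec Bool n → ℕ
  φ G m S = 𝟙 (live? G S) * W m S

  Ψ : Graph n → Vec ℕ n → ℕ
  Ψ G m = ∑ (subsets n) (φ G m)

  live-∷ : ∀ {e G} S → Live (e ∷ G) S → Live G S
  live-∷ S (_ ∷ ind , big) = ind , big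

  Ψ-∷ : ∀ e G m → Ψ (e ∷ G) m ≤ Ψ G m
  Ψ-∷ e G m = ∑-mono (subsets n) λ S →
    *-monoˡ-≤ (W m S) (𝟙-mono (live? (e ∷ G) S) (live? G S) (live-∷ S))

  Ψ-initial : Ψ [] (replicate n 0) * b ^ n ≤ suc b ^ n * W (replicate n 0) ∅
  Ψ-initial rewrite W-zeros-∅ n | sym (∑-W-zeros n) =
    *-monoˡ-≤ (b ^ n) (∑-mono (subsets n) λ S → ≤-trans
      (*-monoˡ-≤ (W (replicate n 0) S) (𝟙≤1 (live? [] S))) (≤-reflexive (*-identityˡ _)))

  module _ (G : Graph n) (m : Vec ℕ n) where

    at : Fin n → Vec Bool n → ℕ
    at u S = 𝟙 (S ∋? u) * φ G m S

    other∈? : (u v : Fin n) (S : Vec Bool n) → Dec (S ∋ v × u ≢ v)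
    other∈? u v S = (S ∋? v) ×-dec ¬? (u Fin.≟ v)

    at₂ : Fin n → Fin n → Vec Bool n → ℕ
    at₂ u v S = 𝟙 (other∈? u v S) * at u S

    Ψ₁ : Fin n → ℕ
    Ψ₁ u = ∑ (subsets n) (at u)

    -- The weight of the live sets that the edge between `u` and `v` would destroy. The condition
    -- `u ≢ v` inside `other∈?` makes the choice `v = u` worthless.
    Ψ₂ : Fin n → Fin n → ℕ
    Ψ₂ u v = ∑ (subsets n) (at₂ u v)

    card-other : ∀ u S → card S ≤ suc (∑ (allFin n) (λ v → 𝟙 (other∈? u v S)))
    card-other u S = begin
      card S ≤⟨ ∑-mono (allFin n) pointwise ⟩
      ∑ (allFin n) (λ v → δ v u + 𝟙 (other∈? u v S)) ≡⟨ ∑-+ (allFin n) _ _ ⟩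
      ∑ (allFin n) (λ v → δ v u) + ∑ (allFin n) (λ v → 𝟙 (other∈? u v S)) ≡⟨ cong (_+ ∑ (allFin n) (λ v → 𝟙 (other∈? u v S))) (∑-δ u) ⟩
      suc (∑ (allFin n) (λ v → 𝟙 (other∈? u v S))) ∎
      where
      open ≤-Reasoning
      pointwise : ∀ v → 𝟙 (S ∋? v) ≤ δ v u + 𝟙 (other∈? u v S)
      pointwise v with v Fin.≟ u
      ... | yes _  = ≤-trans (𝟙≤1 (S ∋? v)) (m≤m+n 1 _)
      ... | no v≢u = 𝟙-mono (S ∋? v) (other∈? u v S) (λ v∈S → v∈S , v≢u ∘ sym)

    -- Double counting: a live set through `u` has at least `t` further members `v`, and is counted
    -- on the right once for each.
    ∑-Ψ₂ : ∀ u → t * Ψ₁ u ≤ ∑ (allFin n) (Ψ₂ u)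
    ∑-Ψ₂ u = begin
      t * Ψ₁ u ≡⟨ sym (∑-* (subsets n) t (at u)) ⟩
      ∑ (subsets n) (λ S → t * at u S) ≤⟨ ∑-mono (subsets n) pointwise ⟩
      ∑ (subsets n) (λ S → ∑ (allFin n) (λ v → 𝟙 (other∈? u v S)) * at u S)
        ≡⟨ ∑-cong (subsets n) (λ S → sym (∑-*ʳ (allFin n) (at u S) (λ v → 𝟙 (other∈? u v S)))) ⟩
      ∑ (subsets n) (λ S → ∑ (allFin n) (λ v → at₂ u v S))
        ≡⟨ ∑-swap (subsets n) (allFin n) (λ S v → at₂ u v S) ⟩
      ∑ (allFin n) (Ψ₂ u) ∎
      where
      open ≤-Reasoning
      pointwise : ∀ S → t * at u S ≤ ∑ (allFin n) (λ v → 𝟙 (other∈? u v S)) * at u S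
      pointwise S with live? G S
      ... | yes (_ , big) = *-monoˡ-≤ _ (s≤s⁻¹ (≤-trans big (card-other u S)))
      ... | no _ rewrite *-zeroʳ (𝟙 (S ∋? u)) = ≤-trans (≤-reflexive (*-zeroʳ t)) z≤n

    average : 0 < n → ∀ u → ∃[ v ] t * Ψ₁ u ≤ n * Ψ₂ u v
    average n>0 u = ∑-≤⇒∃ (allFin n) (λ _ → t * Ψ₁ u) (λ v → n * Ψ₂ u v)
      (subst (0 <_) (sym (length-allFin n)) n>0) (begin
        ∑ (allFin n) (λ _ → t * Ψ₁ u) ≡⟨ ∑-const (allFin n) (t * Ψ₁ u) ⟩
        length (allFin n) * (t * Ψ₁ u) ≡⟨ cong (_* (t * Ψ₁ u)) (length-allFin n) ⟩
        n * (t * Ψ₁ u) ≤⟨ *-monoʳ-≤ n (∑-Ψ₂ u) ⟩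
        n * ∑ (allFin n) (Ψ₂ u) ≡⟨ sym (∑-* (allFin n) n (Ψ₂ u)) ⟩
        ∑ (allFin n) (λ v → n * Ψ₂ u v) ∎)
      where open ≤-Reasoning

    -- Positive weight exhibits an independent set containing both `u` and `v`; hence a profitable
    -- `v` is automatically a non-neighbour.
    Ψ₂-pos : ∀ u v → 0 < Ψ₂ u v → u ≢ v × edge u v ∉ G
    Ψ₂-pos u v pos with ∑-pos⇒∃ (subsets n) (at₂ u v) pos
    ... | S , pos′ with other∈? u v S | S ∋? u | live? G S
    ...   | yes (v∈S , u≢v) | yes u∈S | yes (ind , _) = u≢v , λ e∈G → indep-edge S e∈G ind (u∈S , v∈S)
    ...   | yes _ | yes _ | no _ = ⊥-elim (n≮0 pos′)
    ...   | yes _ | no _  | _    = ⊥-elim (n≮0 pos′)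
    ...   | no _  | _     | _    = ⊥-elim (n≮0 pos′)

    -- If no live weight passes through `u`, any non-neighbour will do. Otherwise an average `v` has
    -- `Ψ₂ u v > 0`, which makes the edge new.
    reply : 0 < t → 0 < n → ∀ u → suc (deg G u) < n →
      ∃[ v ] u ≢ v × edge u v ∉ G × t * Ψ₁ u ≤ n * Ψ₂ u v
    reply t>0 n>0 u d<n with Ψ₁ u in eq
    ... | zero with non-neighbour G u d<n
    ...   | v , u≢v , uv∉G = v , u≢v , uv∉G , ≤-trans (≤-reflexive (*-zeroʳ t)) z≤n
    reply t>0 n>0 u d<n | suc x with average n>0 u
    ...   | v , le with Ψ₂-pos u v (Ψ₂>0 (Ψ₂ u v) (≤-trans (*-mono-≤ t>0 (subst (0 <_) (sym eq) (s≤s z≤n))) le))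
      where
      Ψ₂>0 : ∀ y → 0 < n * y → 0 < y
      Ψ₂>0 zero    lt = subst (0 <_) (*-zeroʳ n) lt
      Ψ₂>0 (suc y) lt = s≤s z≤n
    ...     | u≢v , uv∉G = v , u≢v , uv∉G , subst (λ y → t * y ≤ n * Ψ₂ u v) eq le

    -- Sets avoiding `u` are multiplied by `q`, sets through `u` by `n ≤ q + t`, and sets through
    -- both ends die, which returns `n` times their weight. The choice of `v` makes this return
    -- cover the surplus `t * Ψ₁`.
    Ψ-serve : ∀ u v → t * Ψ₁ u ≤ n * Ψ₂ u v →
      Ψ (edge u v ∷ G) (m [ u ]%= suc) ≤ q * Ψ G m
    Ψ-serve u v good = +-cancelʳ-≤ (n * Ψ₂ u v) _ _ (begin
      Ψ (edge u v ∷ G) m′ + n * Ψ₂ u v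
        ≡⟨ cong (Ψ (edge u v ∷ G) m′ +_) (sym (∑-* (subsets n) n (at₂ u v))) ⟩
      ∑ (subsets n) (φ (edge u v ∷ G) m′) + ∑ (subsets n) (λ S → n * at₂ u v S)
        ≡⟨ sym (∑-+ (subsets n) _ _) ⟩
      ∑ (subsets n) (λ S → φ (edge u v ∷ G) m′ S + n * at₂ u v S) ≤⟨ ∑-mono (subsets n) pointwise ⟩
      ∑ (subsets n) (λ S → q * φ G m S + t * at u S) ≡⟨ ∑-+ (subsets n) _ _ ⟩
      ∑ (subsets n) (λ S → q * φ G m S) + ∑ (subsets n) (λ S → t * at u S)
        ≡⟨ cong₂ _+_ (∑-* (subsets n) q (φ G m)) (∑-* (subsets n) t (at u)) ⟩
      q * Ψ G m + t * Ψ₁ u ≤⟨ +-monoʳ-≤ (q * Ψ G m) good ⟩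
      q * Ψ G m + n * Ψ₂ u v ∎)
      where
      open ≤-Reasoning
      m′ = m [ u ]%= suc
      simp : ∀ q t w → (q + t) * w ≡ q * (w + 0) + t * (w + 0 + 0)
      simp = solve-∀
      nW : ∀ w → n * w ≤ q * (w + 0) + t * (w + 0 + 0)
      nW w = ≤-trans (*-monoˡ-≤ w (≤-trans n≤t+q (≤-reflexive (+-comm t q)))) (≤-reflexive (simp q t w))
      pointwise : ∀ S → φ (edge u v ∷ G) m′ S + n * at₂ u v S ≤ q * φ G m S + t * at u S
      pointwise S with live? (edge u v ∷ G) S | live? G S
      ... | yes lv | no ¬l = ⊥-elim (¬l (live-∷ S lv))
      ... | no _ | no _ rewrite *-zeroʳ (𝟙 (S ∋? u)) | *-zeroʳ (𝟙 (other∈? u v S)) | *-zeroʳ n = z≤n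
      ... | no _ | yes _ with S ∋? u | other∈? u v S
      ...   | yes _ | yes _ = ≤-trans (≤-reflexive (cong (n *_) (trans (+-identityʳ _) (trans (+-identityʳ _) (+-identityʳ _))))) (nW (W m S))
      ...   | yes _ | no _ rewrite *-zeroʳ n = z≤n
      ...   | no _ | o rewrite *-zeroʳ (𝟙 o) | *-zeroʳ n = z≤n
      pointwise S | yes lv@(ind ∷ _ , _) | yes _ rewrite W-serve m S u with S ∋? u | other∈? u v S
      ...   | yes u∈S | yes (v∈S , _) = ⊥-elim (indep-edge {G = edge u v ∷ G} S (here refl) (proj₁ lv) (u∈S , v∈S))
      ...   | yes u∈S | no _ rewrite u∈S | *-zeroʳ n | +-identityʳ (n * W m S) | +-identityʳ (n * W m S) = nW (W m S)
      ...   | no u∉S | o with lookup S u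
      ...     | true  = ⊥-elim (u∉S refl)
      ...     | false rewrite *-zeroʳ (𝟙 o) | *-zeroʳ n | *-zeroʳ t | +-identityʳ (W m S) | +-identityʳ (q * W m S) | +-identityʳ (q * W m S) = ≤-refl

  -- W m ∅ = b ^ n * q ^ sum m, which makes this Ψ G m / q ^ sum m ≤ (b + 1) ^ n, the initial bound.
  Controlled : Graph n → Vec ℕ n → Set
  Controlled G m = Ψ G m * b ^ n ≤ suc b ^ n * W m ∅

  controlled-serve : ∀ {G m} u v → t * Ψ₁ G m u ≤ n * Ψ₂ G m u v → Controlled G m →
    Controlled (edge u v ∷ G) (m [ u ]%= suc)
  controlled-serve {G} {m} u v good inv = begin
    Ψ (edge u v ∷ G) (m [ u ]%= suc) * b ^ n ≤⟨ *-monoˡ-≤ (b ^ n) (Ψ-serve G m u v good) ⟩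
    q * Ψ G m * b ^ n                  ≡⟨ *-assoc q (Ψ G m) (b ^ n) ⟩
    q * (Ψ G m * b ^ n)                ≤⟨ *-monoʳ-≤ q inv ⟩
    q * (suc b ^ n * W m ∅)            ≡⟨ x∙yz≈y∙xz q (suc b ^ n) (W m ∅) ⟩
    suc b ^ n * (q * W m ∅)            ≡⟨ cong (suc b ^ n *_) (cong (λ f → f * W m ∅) (sym (factor∅ u))) ⟩
    suc b ^ n * (factor (lookup ∅ u) * W m ∅) ≡⟨ cong (suc b ^ n *_) (sym (W-serve m ∅ u)) ⟩
    suc b ^ n * W (m [ u ]%= suc) ∅ ∎
    where
    open ≤-Reasoning
    factor∅ : ∀ {l} (u : Fin l) → factor (lookup ∅ u) ≡ q
    factor∅ zero    = refl
    factor∅ (suc u) = factor∅ u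

  controlled-∷ : ∀ {e G m} → Controlled G m → Controlled (e ∷ G) m
  controlled-∷ {e} {G} {m} inv = ≤-trans (*-monoˡ-≤ (b ^ n) (Ψ-∷ e G m)) inv

  -- A larger `S` would be live, so that `4 ^ card S * W m ∅ ≤ W m S ≤ Ψ G m`, while control and
  -- `bound` give `Ψ G m ≤ 2 ^ t * W m ∅`. This contradicts `t < card S`.
  controlled-indep : 0 < b → 0 < q → suc b ^ n ≤ 2 ^ t * b ^ n →
    ∀ {G m} (S : Vec Bool n) → Controlled G m → Indep G S →
    (∀ u → S ∋ u → 4 * (b * q ^ lookup m u) ≤ n ^ lookup m u) → card S ≤ t
  controlled-indep b>0 q>0 bound {G} {m} S inv ind large with t <? card S
  ... | no ≮     = ≮⇒≥ ≮
  ... | yes big = ⊥-elim (<⇒≱ 2^t<4^card 4^card≤2^t)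
    where
    instance
      W>0 : NonZero (W m ∅)
      W>0 = >-nonZero (W-∅-pos b>0 q>0 m)
      b^n>0 : NonZero (b ^ n)
      b^n>0 = m^n≢0 b n {{>-nonZero b>0}}
    W≤Ψ : W m S ≤ Ψ G m
    W≤Ψ = ≤-trans (≤-reflexive (sym (trans (cong (_* W m S) (𝟙-yes (live? G S) (ind , big))) (*-identityˡ _))))
                  (∑-∈ (φ G m) (∈-subsets S))
    4^card≤2^t : 4 ^ card S ≤ 2 ^ t
    4^card≤2^t = *-cancelʳ-≤ _ _ (b ^ n) (*-cancelʳ-≤ _ _ (W m ∅) (begin
      4 ^ card S * b ^ n * W m ∅ ≡⟨ xy∙z≈xz∙y (4 ^ card S) (b ^ n) (W m ∅) ⟩
      4 ^ card S * W m ∅ * b ^ n ≤⟨ *-monoˡ-≤ (b ^ n) (≤-trans (W-large m S large) W≤Ψ) ⟩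
      Ψ G m * b ^ n ≤⟨ inv ⟩
      suc b ^ n * W m ∅ ≤⟨ *-monoˡ-≤ (W m ∅) bound ⟩
      2 ^ t * b ^ n * W m ∅ ∎))
      where open ≤-Reasoning
    2^t<4^card : 2 ^ t < 4 ^ card S
    2^t<4^card = <-≤-trans (^-monoʳ-< 2 (s≤s (s≤s z≤n)) big) (^-monoˡ-≤ (card S) (s≤s (s≤s z≤n)))

-- Potential of the degrees

argmax : {P : A → Set} (P? : ∀ x → Dec (P x)) (f : A → ℕ) (xs : List A) →
  (∀ {x} → x ∈ xs → ¬ P x) ⊎ (∃[ x ] P x × (∀ {y} → y ∈ xs → P y → f y ≤ f x))
argmax P? f [] = inj₁ λ ()
argmax P? f (x ∷ xs) with P? x | argmax P? f xs
... | no ¬px | inj₁ none = inj₁ λ { (here refl) → ¬px ; (there y∈) → none y∈ }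
... | no ¬px | inj₂ (y , py , max) = inj₂ (y , py , λ { (here refl) px → ⊥-elim (¬px px) ; (there z∈) → max z∈ })
... | yes px | inj₁ none = inj₂ (x , px , λ { (here refl) _ → ≤-refl ; (there z∈) pz → ⊥-elim (none z∈ pz) })
... | yes px | inj₂ (y , py , max) with f x ≤? f y
...   | yes fx≤fy = inj₂ (y , py , λ { (here refl) _ → fx≤fy ; (there z∈) → max z∈ })
...   | no fx≰fy = inj₂ (x , px , λ { (here refl) _ → ≤-refl ; (there z∈) pz → ≤-trans (max z∈ pz) (<⇒≤ (≰⇒> fx≰fy)) })

module DegreePotential (n D M : ℕ) where

  -- This is `(5/4) ^ (d ⊓ D)`, scaled by `4 ^ D` to be an integer.
  wd : ℕ → ℕ
  wd d = 5 ^ (d ⊓ D) * 4 ^ (D ∸ d)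

  -- The value 0 at 0 is the cutoff: `wm a` is `4 ^ (M ∸ a)` for `a ≤ M`, with value 1 at `a = M`,
  -- and vanishes beyond.
  quarter : ℕ → ℕ
  quarter zero    = 0
  quarter (suc j) = 4 ^ j

  wm : ℕ → ℕ
  wm a = quarter (suc M ∸ a)

  wd-suc-< : ∀ {d} → d < D → 4 * wd (suc d) ≡ 5 * wd d
  wd-suc-< {d} d<D = begin
    4 * (5 ^ (suc d ⊓ D) * 4 ^ (D ∸ suc d)) ≡⟨ cong (λ x → 4 * (5 ^ x * 4 ^ (D ∸ suc d))) (m≤n⇒m⊓n≡m d<D) ⟩
    4 * (5 * 5 ^ d * 4 ^ (D ∸ suc d))       ≡⟨ eq (5 ^ d) (4 ^ (D ∸ suc d)) ⟩
    5 * (5 ^ d * 4 ^ suc (D ∸ suc d))       ≡⟨ cong₂ (λ x y → 5 * (5 ^ x * 4 ^ y)) (sym (m≤n⇒m⊓n≡m (<⇒≤ d<D))) (sym (+-∸-assoc 1 d<D)) ⟩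
    5 * (5 ^ (d ⊓ D) * 4 ^ (D ∸ d))         ∎
    where
    open ≡-Reasoning
    eq : ∀ x y → 4 * (5 * x * y) ≡ 5 * (x * (4 * y))
    eq = solve-∀

  wd-≥ : ∀ {d} → D ≤ d → wd d ≡ 5 ^ D
  wd-≥ {d} D≤d rewrite m≥n⇒m⊓n≡n D≤d | m≤n⇒m∸n≡0 D≤d = *-identityʳ (5 ^ D)

  wd-suc-≥ : ∀ {d} → D ≤ d → wd (suc d) ≡ wd d
  wd-suc-≥ D≤d = trans (wd-≥ (m≤n⇒m≤1+n D≤d)) (sym (wd-≥ D≤d))

  wd-suc-≤ : ∀ d → 4 * wd (suc d) ≤ 5 * wd d
  wd-suc-≤ d with d <? D
  ... | yes d<D = ≤-reflexive (wd-suc-< d<D)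
  ... | no d≮D rewrite wd-suc-≥ (≮⇒≥ d≮D) = *-monoˡ-≤ (wd d) (n≤1+n 4)

  wm-suc : ∀ a → 4 * wm (suc a) ≤ wm a
  wm-suc a rewrite sym (pred[m∸n]≡m∸[1+n] (suc M) a) = lemma (suc M ∸ a)
    where
    lemma : ∀ j → 4 * quarter (pred j) ≤ quarter j
    lemma zero          = z≤n
    lemma (suc zero)    = z≤n
    lemma (suc (suc j)) = ≤-refl

  wm-zero : ∀ {a} → M < a → wm a ≡ 0
  wm-zero M<a rewrite m≤n⇒m∸n≡0 M<a = refl

  wm-pos : ∀ {a} → a ≤ M → 1 ≤ wm a
  wm-pos {a} a≤M rewrite +-∸-assoc 1 a≤M = m^n>0 4 (M ∸ a)

  -- Growth by 5/4 adds a fifth of the new weight. It is measured by the new weight because Mini's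
  -- move is charged to the active vertices of the position that Max then faces. Past the cap, or
  -- once served enough, nothing is added.
  touch-after : ∀ d a β → (suc d ≤ D → a ≤ M → wd (suc d) * wm a ≤ β) →
    5 * (wd (suc d) * wm a) ≤ 5 * (wd d * wm a) + β
  touch-after d a β bound with d <? D
  ... | no d≮D rewrite wd-suc-≥ (≮⇒≥ d≮D) = m≤m+n _ β
  ... | yes d<D with a ≤? M
  ...   | no a≰M rewrite wm-zero (≰⇒> a≰M) | *-zeroʳ (wd (suc d)) = z≤n
  ...   | yes a≤M = begin
    5 * (wd (suc d) * wm a)                       ≡⟨ split (wd (suc d)) (wm a) ⟩
    4 * wd (suc d) * wm a + wd (suc d) * wm a     ≡⟨ cong (λ x → x * wm a + wd (suc d) * wm a) (wd-suc-< d<D) ⟩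
    5 * wd d * wm a + wd (suc d) * wm a           ≤⟨ +-mono-≤ (≤-reflexive (*-assoc 5 (wd d) (wm a))) (bound d<D a≤M) ⟩
    5 * (wd d * wm a) + β                         ∎
    where
    open ≤-Reasoning
    split : ∀ x y → 5 * (x * y) ≡ 4 * x * y + x * y
    split = solve-∀

  -- The same growth as a quarter of the old weight, for Max's own move, where `β` comes from the
  -- position before it.
  touch-before : ∀ d a β → (d ≤ D → a ≤ M → wd d * wm a ≤ β) →
    16 * (wd (suc d) * wm a) ≤ 16 * (wd d * wm a) + 4 * β
  touch-before d a β bound with d <? D
  ... | no d≮D rewrite wd-suc-≥ (≮⇒≥ d≮D) = m≤m+n _ (4 * β)
  ... | yes d<D with a ≤? M
  ...   | no a≰M rewrite wm-zero (≰⇒> a≰M) | *-zeroʳ (wd (suc d)) = z≤n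
  ...   | yes a≤M = begin
    16 * (wd (suc d) * wm a)                      ≡⟨ split (wd (suc d)) (wm a) ⟩
    4 * (4 * wd (suc d)) * wm a                   ≡⟨ cong (λ x → 4 * x * wm a) (wd-suc-< d<D) ⟩
    4 * (5 * wd d) * wm a                         ≡⟨ split′ (wd d) (wm a) ⟩
    16 * (wd d * wm a) + 4 * (wd d * wm a)        ≤⟨ +-monoʳ-≤ (16 * (wd d * wm a)) (*-monoʳ-≤ 4 (bound (<⇒≤ d<D) a≤M)) ⟩
    16 * (wd d * wm a) + 4 * β                    ∎
    where
    open ≤-Reasoning
    split : ∀ x y → 16 * (x * y) ≡ 4 * (4 * x) * y
    split = solve-∀
    split′ : ∀ x y → 4 * (5 * x) * y ≡ 16 * (x * y) + 4 * (x * y)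
    split′ = solve-∀

  -- The degree costs a factor of at most 5/4 and the service gains at least 4, together 5/16.
  serve : ∀ d a → 16 * (wd (suc d) * wm (suc a)) ≤ 5 * (wd d * wm a)
  serve d a = begin
    16 * (wd (suc d) * wm (suc a))      ≡⟨ split (wd (suc d)) (wm (suc a)) ⟩
    (4 * wd (suc d)) * (4 * wm (suc a)) ≤⟨ *-mono-≤ (wd-suc-≤ d) (wm-suc a) ⟩
    (5 * wd d) * wm a                   ≡⟨ *-assoc 5 (wd d) (wm a) ⟩
    5 * (wd d * wm a)                   ∎
    where
    open ≤-Reasoning
    split : ∀ x y → 16 * (x * y) ≡ (4 * x) * (4 * y)
    split = solve-∀

  h : Graph n → Vec ℕ n → Fin n → ℕ
  h G m u = wd (deg G u) * wm (lookup m u)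

  H : Graph n → Vec ℕ n → ℕ
  H G m = ∑ (allFin n) (h G m)

  Active : Graph n → Vec ℕ n → Fin n → Set
  Active G m u = deg G u ≤ D × lookup m u ≤ M

  active? : ∀ G m u → Dec (Active G m u)
  active? G m u = (deg G u ≤? D) ×-dec (lookup m u ≤? M)

  BoundsActive : Graph n → Vec ℕ n → ℕ → Set
  BoundsActive G m β = ∀ u → Active G m u → h G m u ≤ β

  H-initial : H [] (replicate n 0) ≡ n * (4 ^ D * 4 ^ M)
  H-initial = begin
    H [] (replicate n 0)                    ≡⟨ ∑-cong (allFin n) (λ u → cong₂ _*_ (*-identityˡ (4 ^ D)) (cong wm (lookup-replicate u 0))) ⟩
    ∑ (allFin n) (λ _ → 4 ^ D * 4 ^ M)      ≡⟨ ∑-const (allFin n) _ ⟩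
    length (allFin n) * (4 ^ D * 4 ^ M)     ≡⟨ cong (_* (4 ^ D * 4 ^ M)) (length-allFin n) ⟩
    n * (4 ^ D * 4 ^ M)                     ∎
    where open ≡-Reasoning

  -- Each of the two ends gains at most `β / 5`.
  H-touch : ∀ {i j} G m β → i ≢ j → BoundsActive ((i , j) ∷ G) m β →
    5 * H ((i , j) ∷ G) m ≤ 5 * H G m + 2 * β
  H-touch {i} {j} G m β i≢j bound = begin
    5 * H ((i , j) ∷ G) m ≡⟨ sym (∑-* (allFin n) 5 (h ((i , j) ∷ G) m)) ⟩
    ∑ (allFin n) (λ z → 5 * h ((i , j) ∷ G) m z)
      ≤⟨ ∑-mono (allFin n) (λ z → pointwise z (deg-∷ i j G z) (λ d≤ a≤ → bound z (d≤ , a≤))) ⟩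
    ∑ (allFin n) (λ z → 5 * h G m z + (δ z i * β + δ z j * β)) ≡⟨ ∑-+ (allFin n) _ _ ⟩
    ∑ (allFin n) (λ z → 5 * h G m z) + ∑ (allFin n) (λ z → δ z i * β + δ z j * β)
      ≡⟨ cong₂ _+_ (∑-* (allFin n) 5 (h G m)) (∑-+ (allFin n) _ _) ⟩
    5 * H G m + (∑ (allFin n) (λ z → δ z i * β) + ∑ (allFin n) (λ z → δ z j * β))
      ≡⟨ cong (5 * H G m +_) (cong₂ _+_ (∑-δ* i β) (∑-δ* j β)) ⟩
    5 * H G m + (β + β) ≡⟨ cong (λ x → 5 * H G m + (β + x)) (sym (+-identityʳ β)) ⟩
    5 * H G m + 2 * β ∎
    where
    open ≤-Reasoning
    pointwise : ∀ z {d′} → d′ ≡ (δ z i + δ z j) + deg G z →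
      (d′ ≤ D → lookup m z ≤ M → wd d′ * wm (lookup m z) ≤ β) →
      5 * (wd d′ * wm (lookup m z)) ≤ 5 * h G m z + (δ z i * β + δ z j * β)
    pointwise z refl hyp with z Fin.≟ i | z Fin.≟ j
    ... | yes refl | yes refl = ⊥-elim (i≢j refl)
    ... | yes _ | no _ rewrite +-identityʳ β | +-identityʳ β = touch-after (deg G z) (lookup m z) β hyp
    ... | no _ | yes _ rewrite +-identityʳ β = touch-after (deg G z) (lookup m z) β hyp
    ... | no _ | no _ = m≤m+n _ 0

  -- In sixteenths of `h G m u`: the served vertex drops from 16 to at most 5, and `v` gains at most
  -- 4 because no active vertex is heavier than `u`.
  H-serve : ∀ {u v} G m → u ≢ v → BoundsActive G m (h G m u) →
    16 * H (edge u v ∷ G) (m [ u ]%= suc) + 11 * h G m u ≤ 16 * H G m + 4 * h G m u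
  H-serve {u} {v} G m u≢v bound = begin
    16 * H G′ m′ + 11 * β ≡⟨ cong₂ _+_ (sym (∑-* (allFin n) 16 (h G′ m′))) (sym (∑-δ* u (11 * β))) ⟩
    ∑ (allFin n) (λ z → 16 * h G′ m′ z) + ∑ (allFin n) (λ z → δ z u * (11 * β)) ≡⟨ sym (∑-+ (allFin n) _ _) ⟩
    ∑ (allFin n) (λ z → 16 * h G′ m′ z + δ z u * (11 * β))
      ≤⟨ ∑-mono (allFin n) (λ z → pointwise z (deg-edge u v G z)) ⟩
    ∑ (allFin n) (λ z → 16 * h G m z + δ z v * (4 * β)) ≡⟨ ∑-+ (allFin n) _ _ ⟩
    ∑ (allFin n) (λ z → 16 * h G m z) + ∑ (allFin n) (λ z → δ z v * (4 * β))
      ≡⟨ cong₂ _+_ (∑-* (allFin n) 16 (h G m)) (∑-δ* v (4 * β)) ⟩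
    16 * H G m + 4 * β ∎
    where
    open ≤-Reasoning
    G′ = edge u v ∷ G
    m′ = m [ u ]%= suc
    β = h G m u
    combine : ∀ x → 5 * x + (11 * x + 0) ≡ 16 * x + 0
    combine = solve-∀
    pointwise : ∀ z {d′} → d′ ≡ (δ z u + δ z v) + deg G z →
      16 * (wd d′ * wm (lookup m′ z)) + δ z u * (11 * β) ≤ 16 * h G m z + δ z v * (4 * β)
    pointwise z refl with z Fin.≟ u | z Fin.≟ v
    ... | yes refl | yes refl = ⊥-elim (u≢v refl)
    ... | yes refl | no _ rewrite lookup∘updateAt z {suc} m = ≤-trans
      (+-monoˡ-≤ (11 * β + 0) (serve (deg G z) (lookup m z)))
      (≤-reflexive (combine β))
    ... | no z≢u | yes _ rewrite lookup∘updateAt′ z u {suc} z≢u m | +-identityʳ (4 * β) = ≤-trans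
      (≤-reflexive (+-identityʳ _))
      (touch-before (deg G z) (lookup m z) β (λ d≤ a≤ → bound z (d≤ , a≤)))
    ... | no z≢u | no _ rewrite lookup∘updateAt′ z u {suc} z≢u m = ≤-refl

  unserved : Vec ℕ n → ℕ
  unserved m = ∑ (allFin n) (λ u → 𝟙 (lookup m u ≤? M))

  -- With no active vertex left, a vertex served at most `M` times has degree above `D`, so its
  -- degree weight has reached the cap `5 ^ D`.
  unserved-≤ : ∀ G m → (∀ u → ¬ Active G m u) → 5 ^ D * unserved m ≤ H G m
  unserved-≤ G m none = ≤-trans (≤-reflexive (sym (∑-* (allFin n) (5 ^ D) _))) (∑-mono (allFin n) pointwise)
    where
    pointwise : ∀ u → 5 ^ D * 𝟙 (lookup m u ≤? M) ≤ h G m u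
    pointwise u with lookup m u ≤? M
    ... | no _    rewrite *-zeroʳ (5 ^ D) = z≤n
    ... | yes a≤M = *-mono-≤ (≤-reflexive (sym (wd-≥ (<⇒≤ (≰⇒> (λ d≤D → none u (d≤D , a≤M))))))) (wm-pos a≤M)

  -- Before Max's move the excess caused by Mini is at most 2/5 of the heaviest active vertex,
  -- which is what Max then serves.
  Debt : Player → Graph n → Vec ℕ n → Set
  Debt Mini G m = H G m ≤ n * (4 ^ D * 4 ^ M)
  Debt Max  G m = ∀ β → BoundsActive G m β → 5 * H G m ≤ 5 * (n * (4 ^ D * 4 ^ M)) + 2 * β

  debt-Mini : ∀ {i j G m} → i ≢ j → Debt Mini G m → Debt Max ((i , j) ∷ G) m
  debt-Mini {G = G} {m} i≢j debt β bound =
    ≤-trans (H-touch G m β i≢j bound) (+-monoˡ-≤ (2 * β) (*-monoʳ-≤ 5 debt))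

  debt-settled : ∀ p {G m} → (∀ u → ¬ Active G m u) → Debt p G m → H G m ≤ n * (4 ^ D * 4 ^ M)
  debt-settled Mini none debt = debt
  -- Without active vertices `β = 0` is an admissible bound, and the debt vanishes.
  debt-settled Max {G} {m} none debt = *-cancelˡ-≤ 5 (≤-trans (debt 0 (λ u act → ⊥-elim (none u act))) (≤-reflexive (+-identityʳ _)))

  -- Degrees only grow, so no vertex becomes active again and a further edge adds no weight.
  debt-idle : ∀ {i j G m} → i ≢ j → (∀ u → ¬ Active G m u) → Debt Max G m → Debt Mini ((i , j) ∷ G) m
  debt-idle {i} {j} {G} {m} i≢j none debt = ≤-trans
    (*-cancelˡ-≤ 5 (≤-trans (H-touch G m 0 i≢j (λ u act → ⊥-elim (none u (before act)))) (≤-reflexive (+-identityʳ _))))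
    (debt-settled Max {G} {m} none debt)
    where
    before : ∀ {u} → Active ((i , j) ∷ G) m u → Active G m u
    before {u} (d≤D , a≤M) = ≤-trans (≤-trans (m≤n+m _ (δ u i + δ u j)) (≤-reflexive (sym (deg-∷ i j G u)))) d≤D , a≤M

  debt-serve : ∀ {u v G m} → u ≢ v → BoundsActive G m (h G m u) → Debt Max G m →
    Debt Mini (edge u v ∷ G) (m [ u ]%= suc)
  debt-serve {u} {v} {G} {m} u≢v bound debt =
    arith (H (edge u v ∷ G) (m [ u ]%= suc)) (H G m) _ (h G m u) (H-serve G m u≢v bound) (debt _ bound)
    where
    -- In units of `β / 80`, the debt of 32 and the gain of 20 at `v` make 52, and the drop of 55 at
    -- `u` pays for them.
    arith : ∀ x y z β → 16 * x + 11 * β ≤ 16 * y + 4 * β → 5 * y ≤ 5 * z + 2 * β → x ≤ z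
    arith x y z β p q = *-cancelˡ-≤ 80 (+-cancelʳ-≤ (55 * β) _ _ (begin
      80 * x + 55 * β                 ≡⟨ e₁ x β ⟩
      5 * (16 * x + 11 * β)           ≤⟨ *-monoʳ-≤ 5 p ⟩
      5 * (16 * y + 4 * β)            ≡⟨ e₂ y β ⟩
      16 * (5 * y) + 20 * β           ≤⟨ +-monoˡ-≤ (20 * β) (*-monoʳ-≤ 16 q) ⟩
      16 * (5 * z + 2 * β) + 20 * β   ≡⟨ e₃ z β ⟩
      80 * z + 52 * β                 ≤⟨ +-monoʳ-≤ (80 * z) (*-monoˡ-≤ β (m≤m+n 52 3)) ⟩
      80 * z + 55 * β                 ∎))
      where
      open ≤-Reasoning
      e₁ : ∀ x β → 80 * x + 55 * β ≡ 5 * (16 * x + 11 * β)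
      e₁ = solve-∀
      e₂ : ∀ y β → 5 * (16 * y + 4 * β) ≡ 16 * (5 * y) + 20 * β
      e₂ = solve-∀
      e₃ : ∀ z β → 16 * (5 * z + 2 * β) + 20 * β ≡ 80 * z + 52 * β
      e₃ = solve-∀

  debt-initial : ∀ p → Debt p [] (replicate n 0)
  debt-initial Mini     = ≤-reflexive H-initial
  debt-initial Max β _  = ≤-trans (≤-reflexive (cong (5 *_) H-initial)) (m≤m+n _ (2 * β))

-- The strategy of Max

does-true : (P? : Dec P) → does P? ≡ true → P
does-true (yes p) _ = p

best-Mini : {P : ℕ → Set} {x : ℕ} {xs : List ℕ} → P x → All P xs → P (best Mini x xs)
best-Mini px [] = px
best-Mini {P} {x} {y ∷ xs} px (py ∷ pxs) with ⊓-sel y (best Mini x xs)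
... | inj₁ eq = subst P (sym eq) py
... | inj₂ eq = subst P (sym eq) (best-Mini px pxs)

best-Max : {x y : ℕ} (xs : List ℕ) → y ∈ x ∷ xs → y ≤ best Max x xs
best-Max []       (here refl)         = ≤-refl
best-Max (z ∷ xs) (here refl)         = ≤-trans (best-Max xs (here refl)) (m≤n⊔m z _)
best-Max (z ∷ xs) (there (here refl)) = m≤m⊔n z _
best-Max (z ∷ xs) (there (there y∈))  = ≤-trans (best-Max xs (there y∈)) (m≤n⊔m z _)

-- Here `k = 2 + D`, and more than `M` services count as enough. `expand` bounds the initial total
-- weight relative to the empty set by `2 ^ t`, `power` yields the gain of 4 per well served vertex,
-- and `error` turns colour classes of size at most `t + x` into the final loss.
module Strategy
  (n D M b q t E : ℕ)
  (k≤n : 2 + D ≤ n) (b>0 : 0 < b) (q>0 : 0 < q) (t>0 : 0 < t) (n≤t+q : n ≤ t + q)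
  (expand : suc b ^ n ≤ 2 ^ t * b ^ n)
  (power : ∀ a → M < a → 4 * (b * q ^ a) ≤ n ^ a)
  (error : ∀ x → 5 ^ D * x ≤ n * (4 ^ D * 4 ^ M) → (2 + D) * (n * (t + x)) ≤ 2 * E)
  where

  open IndepPotential n b q t n≤t+q
  open DegreePotential n D M

  k : ℕ
  k = 2 + D

  record Invariant (p : Player) (G : Graph n) (m : Vec ℕ n) : Set where
    field
      canonical  : Canonical G
      colorable  : Colorable k G
      controlled : Controlled G m
      debt       : Debt p G m

  open Invariant

  legal-at : {G : Graph n} {u v : Fin n} → Canonical G → Colorable k G → deg G u ≤ D → u ≢ v → edge u v ∉ G →
    edge u v ∈ legalEdges k G
  legal-at can col d≤D u≢v uv∉G = ∈-legalEdges⁺ (edge-canonical u≢v) uv∉G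
    (colorable-edge can col (s≤s (s≤s d≤D)) u≢v)

  answer : ∀ G m u → deg G u ≤ D → ∃[ v ] u ≢ v × edge u v ∉ G × t * Ψ₁ G m u ≤ n * Ψ₂ G m u v
  answer G m u d≤D = reply G m t>0 (≤-trans (s≤s z≤n) k≤n) u (≤-trans (s≤s (s≤s d≤D)) k≤n)

  -- The members of a colour class with more than `M` services form an independent set, to which the
  -- potential bound `t` applies; the rest are unserved.
  class-≤ : ∀ {G m} (c : Vec (Fin k) n) → Proper k G c → Controlled G m → ∀ i →
    ∑ (allFin n) (λ j → 𝟙 (lookup c i Fin.≟ lookup c j)) ≤ t + unserved m
  class-≤ {G} {m} c proper ctl i = begin
    ∑ (allFin n) (λ j → 𝟙 (lookup c i Fin.≟ lookup c j)) ≤⟨ ∑-mono (allFin n) pointwise ⟩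
    ∑ (allFin n) (λ j → 𝟙 (S ∋? j) + 𝟙 (lookup m j ≤? M)) ≡⟨ ∑-+ (allFin n) _ _ ⟩
    card S + unserved m ≤⟨ +-monoˡ-≤ (unserved m) (controlled-indep b>0 q>0 expand {G} {m} S ctl indep large) ⟩
    t + unserved m ∎
    where
    open ≤-Reasoning
    in? : ∀ j → Dec (lookup c i ≡ lookup c j × M < lookup m j)
    in? j = (lookup c i Fin.≟ lookup c j) ×-dec (M <? lookup m j)
    S : Vec Bool n
    S = tabulate (does ∘ in?)
    ∈S : ∀ {j} → S ∋ j → lookup c i ≡ lookup c j × M < lookup m j
    ∈S {j} j∈S = does-true (in? j) (trans (sym (lookup∘tabulate (does ∘ in?) j)) j∈S)
    indep : Indep G S
    indep = All.map (λ distinct (i∈S , j∈S) → distinct (trans (sym (proj₁ (∈S i∈S))) (proj₁ (∈S j∈S)))) proper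
    large : ∀ u → S ∋ u → 4 * (b * q ^ lookup m u) ≤ n ^ lookup m u
    large u u∈S = power (lookup m u) (proj₂ (∈S u∈S))
    pointwise : ∀ j → 𝟙 (lookup c i Fin.≟ lookup c j) ≤ 𝟙 (S ∋? j) + 𝟙 (lookup m j ≤? M)
    pointwise j with lookup m j ≤? M
    ... | yes _ = ≤-trans (𝟙≤1 (lookup c i Fin.≟ lookup c j)) (m≤n+m 1 _)
    ... | no a≰M = ≤-trans (𝟙-mono (lookup c i Fin.≟ lookup c j) (S ∋? j)
        (λ ci≡cj → trans (lookup∘tabulate (does ∘ in?) j) (dec-true (in? j) (ci≡cj , ≰⇒> a≰M)))) (m≤m+n _ 0)

  -- The lower bound on the score multiplied by `k`, so `E` is `k` times the tolerated number of
  -- missing edges.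
  Enough : ℕ → Set
  Enough s = k * (n C 2) ≤ k * s + E

  enough-mono : ∀ {s s′} → s ≤ s′ → Enough s → Enough s′
  enough-mono s≤s′ en = ≤-trans en (+-monoˡ-≤ E (*-monoʳ-≤ k s≤s′))

  -- An active vertex would still offer a legal edge, so none is left. Moreover any pair bichromatic
  -- under the colouring `c` is an edge, since adding it would keep `c` proper.
  enough-saturated : ∀ {p} {G : Graph n} {m} → Invariant p G m → (∀ e → e ∉ legalEdges k G) → Enough (length G)
  enough-saturated {p} {G} {m} inv over with colorable inv
  ... | c , proper = *-cancelˡ-≤ 2 (begin
    2 * (k * (n C 2))                                   ≡⟨ x∙yz≈y∙xz 2 k (n C 2) ⟩
    k * (2 * (n C 2))                                   ≤⟨ *-monoʳ-≤ k (saturated-size G c (t + unserved m) saturated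
                                                            (λ i → m≤n⇒m≤1+n (class-≤ {G} {m} c proper (controlled inv) i))) ⟩
    k * (2 * length G + n * (t + unserved m))           ≡⟨ *-distribˡ-+ k (2 * length G) (n * (t + unserved m)) ⟩
    k * (2 * length G) + k * (n * (t + unserved m))     ≤⟨ +-monoʳ-≤ (k * (2 * length G)) (error (unserved m)
                                                            (≤-trans (unserved-≤ G m none) (debt-settled p {G} {m} none (debt inv)))) ⟩
    k * (2 * length G) + 2 * E                          ≡⟨ cong (_+ 2 * E) (x∙yz≈y∙xz k 2 (length G)) ⟩
    2 * (k * length G) + 2 * E                          ≡⟨ sym (*-distribˡ-+ 2 (k * length G) E) ⟩
    2 * (k * length G + E)                              ∎)
    where
    open ≤-Reasoning
    none : ∀ u → ¬ Active G m u
    none u (d≤D , _) with answer G m u d≤D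
    ... | v , u≢v , uv∉G , _ = over (edge u v) (legal-at (canonical inv) (c , proper) d≤D u≢v uv∉G)
    saturated : ∀ i j → toℕ i < toℕ j → lookup c i ≢ lookup c j → (i , j) ∈ G
    saturated i j i<j ci≢cj with (i , j) ∈ᴱ? G
    ... | yes ij∈G = ij∈G
    ... | no ij∉G = ⊥-elim (over (i , j) (∈-legalEdges⁺ i<j ij∉G (c , ci≢cj ∷ proper)))

  step-Mini : ∀ {G : Graph n} {m e} → Invariant Mini G m → e ∈ legalEdges k G → Invariant Max (e ∷ G) m
  step-Mini {G} {m} {e} inv e∈ = record
    { canonical  = proj₁ legal ∷ canonical inv
    ; colorable  = proj₂ legal
    ; controlled = controlled-∷ {e} {G} {m} (controlled inv)
    ; debt       = debt-Mini {G = G} {m} (canonical⇒≢ (proj₁ legal)) (debt inv)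
    }
    where legal = ∈-legalEdges⁻ e∈

  -- Max serves a heaviest active vertex. If there is none, he plays the given legal edge `e` and
  -- records no service.
  step-Max : ∀ {G : Graph n} {m e} → Invariant Max G m → e ∈ legalEdges k G →
    ∃[ e′ ] ∃[ m′ ] e′ ∈ legalEdges k G × Invariant Mini (e′ ∷ G) m′
  step-Max {G} {m} {e} inv e∈ with argmax (active? G m) (h G m) (allFin n)
  ... | inj₁ none = e , m , e∈ , record
    { canonical  = proj₁ legal ∷ canonical inv
    ; colorable  = proj₂ legal
    ; controlled = controlled-∷ {e} {G} {m} (controlled inv)
    ; debt       = debt-idle {G = G} {m} (canonical⇒≢ (proj₁ legal)) (λ u → none (∈-allFin u)) (debt inv)
    }
    where legal = ∈-legalEdges⁻ e∈
  ... | inj₂ (u , (d≤D , _) , max) with answer G m u d≤D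
  ...   | v , u≢v , uv∉G , good = edge u v , m [ u ]%= suc , uv∈ , record
    { canonical  = edge-canonical u≢v ∷ canonical inv
    ; colorable  = proj₂ (∈-legalEdges⁻ uv∈)
    ; controlled = controlled-serve {G} {m} u v good (controlled inv)
    ; debt       = debt-serve {G = G} {m} u≢v (λ w → max (∈-allFin w)) (debt inv)
    }
    where uv∈ = legal-at (canonical inv) (colorable inv) d≤D u≢v uv∉G

  -- Induction on the fuel. The hypothesis on `f + length G` is preserved by each move and makes the
  -- claim trivial when the fuel runs out.
  enough-value : ∀ f p {G : Graph n} {m} → Invariant p G m → n C 2 ≤ f + length G → Enough (value k f p G)
  enough-value zero p inv long = ≤-trans (*-monoʳ-≤ k long) (m≤m+n _ E)
  enough-value (suc f) p {G} {m} inv long with legalEdges k G in eq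
  ... | [] = enough-saturated {p} {G} {m} inv λ e e∈ → ¬Any[] (subst (e ∈_) eq e∈)
  enough-value (suc f) Mini {G} {m} inv long | e ∷ es =
    best-Mini {P = Enough} (play (here refl)) (All.map⁺ (All.tabulate (λ e∈ → play (there e∈))))
    where
    play : ∀ {e′} → e′ ∈ e ∷ es → Enough (value k f Max (e′ ∷ G))
    play e∈ = enough-value f Max {m = m} (step-Mini inv (subst (_ ∈_) (sym eq) e∈))
      (≤-trans long (≤-reflexive (sym (+-suc f (length G)))))
  enough-value (suc f) Max {G} {m} inv long | e ∷ es
    with step-Max inv (subst (e ∈_) (sym eq) (here refl))
  ... | e′ , m′ , e′∈ , inv′ = enough-mono
    (best-Max _ (∈-map⁺ (λ e″ → value k f Mini (e″ ∷ G)) (subst (e′ ∈_) eq e′∈)))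
    (enough-value f Mini {m = m′} inv′ (≤-trans long (≤-reflexive (sym (+-suc f (length G))))))

  enough-score : ∀ first → Enough (score n k first)
  enough-score first = enough-value (n C 2) first {m = replicate n 0} (record
    { canonical  = []
    ; colorable  = replicate n zero , []
    ; controlled = Ψ-initial
    ; debt       = debt-initial first
    }) (m≤m+n _ 0)

-- Choice of the parameters

^-distribʳ-* : ∀ x y n → (x * y) ^ n ≡ x ^ n * y ^ n
^-distribʳ-* x y zero    = refl
^-distribʳ-* x y (suc n) rewrite ^-distribʳ-* x y n = eq x y (x ^ n) (y ^ n)
  where
  eq : ∀ x y z w → x * y * (z * w) ≡ x * z * (y * w)
  eq = solve-∀

-- `(1 + 1/b) ^ j ≥ 1 + j/b`, cleared of denominators.
bernoulli-lower : ∀ b j → (b + j) * b ^ j ≤ suc b ^ j * b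
bernoulli-lower b zero    = ≤-reflexive (eq b)
  where
  eq : ∀ b → (b + 0) * 1 ≡ 1 * b
  eq = solve-∀
bernoulli-lower b (suc j) = begin
  (b + suc j) * (b * b ^ j)           ≤⟨ m≤m+n _ (j * b ^ j) ⟩
  (b + suc j) * (b * b ^ j) + j * b ^ j ≡⟨ e₁ b j (b ^ j) ⟩
  suc b * ((b + j) * b ^ j)           ≤⟨ *-monoʳ-≤ (suc b) (bernoulli-lower b j) ⟩
  suc b * (suc b ^ j * b)             ≡⟨ sym (*-assoc (suc b) (suc b ^ j) b) ⟩
  suc b * suc b ^ j * b               ∎
  where
  open ≤-Reasoning
  e₁ : ∀ b j x → (b + suc j) * (b * x) + j * x ≡ suc b * ((b + j) * x)
  e₁ = solve-∀

-- `(1 - 1/(b+1)) ^ j ≥ 1 - j/(b+1)`, cleared of denominators; `s` stands for `b + 1 - j`.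
bernoulli-upper : ∀ b j s → j + s ≡ suc b → suc b ^ j * s ≤ suc b * b ^ j
bernoulli-upper b zero    s refl = ≤-reflexive (*-comm 1 (suc b))
bernoulli-upper b (suc j) s eq = begin
  suc b * suc b ^ j * s     ≡⟨ e₁ (suc b) (suc b ^ j) s ⟩
  suc b ^ j * (s + b * s)   ≤⟨ *-monoʳ-≤ (suc b ^ j) (+-monoˡ-≤ (b * s) (≤-trans (m≤n+m s j) (≤-reflexive (suc-injective eq)))) ⟩
  suc b ^ j * (b + b * s)   ≡⟨ e₂ (suc b ^ j) b s ⟩
  b * (suc b ^ j * suc s)   ≤⟨ *-monoʳ-≤ b (bernoulli-upper b j (suc s) (trans (+-suc j s) eq)) ⟩
  b * (suc b * b ^ j)       ≡⟨ x∙yz≈y∙xz b (suc b) (b ^ j) ⟩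
  suc b * (b * b ^ j)       ∎
  where
  open ≤-Reasoning
  e₁ : ∀ x y s → x * y * s ≡ y * (x * s)
  e₁ = solve-∀
  e₂ : ∀ y b s → y * (b + b * s) ≡ b * (y * suc s)
  e₂ = solve-∀

[1+1/b]^b≥2 : ∀ b → 0 < b → 2 * b ^ b ≤ suc b ^ b
[1+1/b]^b≥2 b b>0 = *-cancelʳ-≤ _ _ b {{>-nonZero b>0}}
  (≤-trans (≤-reflexive (eq b (b ^ b))) (bernoulli-lower b b))
  where
  eq : ∀ b x → 2 * x * b ≡ (b + b) * x
  eq = solve-∀

-- Bernoulli bounds the power by `(2r+1)/(r+1)`, which is below 2.
[1+1/2r]^r≤2 : ∀ r → suc (2 * r) ^ r ≤ 2 * (2 * r) ^ r
[1+1/2r]^r≤2 r = *-cancelʳ-≤ _ _ (suc r) (begin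
  suc (2 * r) ^ r * suc r        ≤⟨ bernoulli-upper (2 * r) r (suc r) (e₁ r) ⟩
  suc (2 * r) * (2 * r) ^ r      ≤⟨ m≤n+m _ ((2 * r) ^ r) ⟩
  (2 * r) ^ r + suc (2 * r) * (2 * r) ^ r ≡⟨ e₂ r ((2 * r) ^ r) ⟩
  2 * (2 * r) ^ r * suc r        ∎)
  where
  open ≤-Reasoning
  e₁ : ∀ r → r + suc r ≡ suc (2 * r)
  e₁ = solve-∀
  e₂ : ∀ r x → x + suc (2 * r) * x ≡ 2 * x * suc r
  e₂ = solve-∀

-- The `t`-th power of the previous bound settles the exponent `r * t`; the `s` surplus factors are
-- removed by `b ≤ suc b`.
[1+1/2r]^n≤2^t : ∀ r n t → n ≤ r * t → suc (2 * r) ^ n ≤ 2 ^ t * (2 * r) ^ n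
[1+1/2r]^n≤2^t r n t n≤rt = *-cancelʳ-≤ _ _ (suc b ^ s) {{m^n≢0 (suc b) s}} (begin
  suc b ^ n * suc b ^ s     ≡⟨ sym (^-distribˡ-+-* (suc b) n s) ⟩
  suc b ^ (n + s)           ≡⟨ cong (suc b ^_) (m+[n∸m]≡n n≤rt) ⟩
  suc b ^ (r * t)           ≡⟨ sym (^-*-assoc (suc b) r t) ⟩
  (suc b ^ r) ^ t           ≤⟨ ^-monoˡ-≤ t ([1+1/2r]^r≤2 r) ⟩
  (2 * b ^ r) ^ t           ≡⟨ ^-distribʳ-* 2 (b ^ r) t ⟩
  2 ^ t * (b ^ r) ^ t       ≡⟨ cong (2 ^ t *_) (^-*-assoc b r t) ⟩
  2 ^ t * b ^ (r * t)       ≡⟨ cong (λ x → 2 ^ t * b ^ x) (sym (m+[n∸m]≡n n≤rt)) ⟩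
  2 ^ t * b ^ (n + s)       ≡⟨ cong (2 ^ t *_) (^-distribˡ-+-* b n s) ⟩
  2 ^ t * (b ^ n * b ^ s)   ≡⟨ sym (*-assoc (2 ^ t) (b ^ n) (b ^ s)) ⟩
  2 ^ t * b ^ n * b ^ s     ≤⟨ *-monoʳ-≤ (2 ^ t * b ^ n) (^-monoˡ-≤ s (n≤1+n b)) ⟩
  2 ^ t * b ^ n * suc b ^ s ∎)
  where
  open ≤-Reasoning
  b = 2 * r
  s = r * t ∸ n

-- Since `t` is at least `n / (r+1)`, the ratio `n / q` is at least `1 + 1/r`, whose `r`-th power is
-- at least 2; and `a` contains `L` blocks of length `r`.
shrink-power : ∀ r n t q L a → 0 < r → t + q ≡ n → n ≤ suc r * t → r * L ≤ a →
  2 ^ L * q ^ a ≤ n ^ a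
shrink-power r n t q L a r>0 t+q≡n n≤rt rL≤a = begin
  2 ^ L * q ^ a                     ≡⟨ cong (λ x → 2 ^ L * q ^ x) (sym (m+[n∸m]≡n rL≤a)) ⟩
  2 ^ L * q ^ (r * L + s)           ≡⟨ cong (2 ^ L *_) (^-distribˡ-+-* q (r * L) s) ⟩
  2 ^ L * (q ^ (r * L) * q ^ s)     ≡⟨ sym (*-assoc (2 ^ L) (q ^ (r * L)) (q ^ s)) ⟩
  2 ^ L * q ^ (r * L) * q ^ s       ≡⟨ cong (λ x → 2 ^ L * x * q ^ s) (sym (^-*-assoc q r L)) ⟩
  2 ^ L * (q ^ r) ^ L * q ^ s       ≡⟨ cong (_* q ^ s) (sym (^-distribʳ-* 2 (q ^ r) L)) ⟩
  (2 * q ^ r) ^ L * q ^ s           ≤⟨ *-mono-≤ (^-monoˡ-≤ L 2q^r≤n^r) (^-monoˡ-≤ s q≤n) ⟩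
  (n ^ r) ^ L * n ^ s               ≡⟨ cong (_* n ^ s) (^-*-assoc n r L) ⟩
  n ^ (r * L) * n ^ s               ≡⟨ sym (^-distribˡ-+-* n (r * L) s) ⟩
  n ^ (r * L + s)                   ≡⟨ cong (n ^_) (m+[n∸m]≡n rL≤a) ⟩
  n ^ a                             ∎
  where
  open ≤-Reasoning
  s = a ∸ r * L
  q≤n : q ≤ n
  q≤n = ≤-trans (m≤n+m q t) (≤-reflexive t+q≡n)
  rq≤rn : suc r * q ≤ r * n
  rq≤rn = +-cancelˡ-≤ (suc r * t) _ _ (begin
    suc r * t + suc r * q ≡⟨ sym (*-distribˡ-+ (suc r) t q) ⟩
    suc r * (t + q)       ≡⟨ cong (suc r *_) t+q≡n ⟩
    n + r * n             ≤⟨ +-monoˡ-≤ (r * n) n≤rt ⟩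
    suc r * t + r * n     ∎)
  2q^r≤n^r : 2 * q ^ r ≤ n ^ r
  2q^r≤n^r = *-cancelˡ-≤ (suc r ^ r) {{m^n≢0 (suc r) r}} (begin
    suc r ^ r * (2 * q ^ r) ≡⟨ x∙yz≈y∙xz (suc r ^ r) 2 (q ^ r) ⟩
    2 * (suc r ^ r * q ^ r) ≡⟨ cong (2 *_) (sym (^-distribʳ-* (suc r) q r)) ⟩
    2 * (suc r * q) ^ r     ≤⟨ *-monoʳ-≤ 2 (^-monoˡ-≤ r rq≤rn) ⟩
    2 * (r * n) ^ r         ≡⟨ cong (2 *_) (^-distribʳ-* r n r) ⟩
    2 * (r ^ r * n ^ r)     ≡⟨ sym (*-assoc 2 (r ^ r) (n ^ r)) ⟩
    2 * r ^ r * n ^ r       ≤⟨ *-monoˡ-≤ (n ^ r) ([1+1/b]^b≥2 r r>0) ⟩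
    suc r ^ r * n ^ r       ∎)

suc-≤-4^ : ∀ m → suc m ≤ 4 ^ m
suc-≤-4^ zero    = ≤-refl
suc-≤-4^ (suc m) = begin
  suc (suc m)         ≤⟨ s≤s (m≤n+m (suc m) m) ⟩
  suc (m + suc m)     ≤⟨ m≤m+n _ (2 * suc m) ⟩
  suc (m + suc m) + 2 * suc m ≡⟨ e m ⟩
  4 * suc m           ≤⟨ *-monoʳ-≤ 4 (suc-≤-4^ m) ⟩
  4 * 4 ^ m           ∎
  where
  open ≤-Reasoning
  e : ∀ m → suc (m + suc m) + 2 * suc m ≡ 4 * suc m
  e = solve-∀

-- The numerical core is `4 ^ 16 ≤ 5 ^ 14`: it lets `(5/4) ^ (14 * M)` absorb two factors `4 ^ M`,
-- one of which dominates `suc M`.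
few-unserved : ∀ D M → M * 14 ≤ D → suc M * (4 ^ D * 4 ^ M) ≤ 5 ^ D
few-unserved D M 14M≤D = begin
  suc M * (4 ^ D * 4 ^ M)             ≤⟨ *-monoˡ-≤ (4 ^ D * 4 ^ M) (suc-≤-4^ M) ⟩
  4 ^ M * (4 ^ D * 4 ^ M)             ≡⟨ cong (λ x → 4 ^ M * (4 ^ x * 4 ^ M)) (sym (m+[n∸m]≡n 14M≤D)) ⟩
  4 ^ M * (4 ^ (M * 14 + s) * 4 ^ M)  ≡⟨ cong (λ x → 4 ^ M * (x * 4 ^ M)) (^-distribˡ-+-* 4 (M * 14) s) ⟩
  4 ^ M * (4 ^ (M * 14) * 4 ^ s * 4 ^ M) ≡⟨ e (4 ^ M) (4 ^ (M * 14)) (4 ^ s) ⟩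
  4 ^ (M * 14) * (4 ^ M * (4 ^ M * 1)) * 4 ^ s ≡⟨ cong (λ x → 4 ^ (M * 14) * x * 4 ^ s) (^-*-assoc 4 M 2) ⟩
  4 ^ (M * 14) * 4 ^ (M * 2) * 4 ^ s  ≡⟨ cong (_* 4 ^ s) (sym (^-distribˡ-+-* 4 (M * 14) (M * 2))) ⟩
  4 ^ (M * 14 + M * 2) * 4 ^ s        ≡⟨ cong (λ x → 4 ^ x * 4 ^ s) (trans (sym (*-distribˡ-+ M 14 2)) (*-comm M 16)) ⟩
  4 ^ (16 * M) * 4 ^ s                ≡⟨ cong (_* 4 ^ s) (sym (^-*-assoc 4 16 M)) ⟩
  (4 ^ 16) ^ M * 4 ^ s                ≤⟨ *-mono-≤ (^-monoˡ-≤ M (toWitness {a? = 4 ^ 16 ≤? 5 ^ 14} _)) (^-monoˡ-≤ s (n≤1+n 4)) ⟩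
  (5 ^ 14) ^ M * 5 ^ s                ≡⟨ cong (_* 5 ^ s) (trans (^-*-assoc 5 14 M) (cong (5 ^_) (*-comm 14 M))) ⟩
  5 ^ (M * 14) * 5 ^ s                ≡⟨ sym (^-distribˡ-+-* 5 (M * 14) s) ⟩
  5 ^ (M * 14 + s)                    ≡⟨ cong (5 ^_) (m+[n∸m]≡n 14M≤D) ⟩
  5 ^ D                               ∎
  where
  open ≤-Reasoning
  s = D ∸ M * 14
  e : ∀ x y z → x * (y * z * x) ≡ y * (x * (x * 1)) * z
  e = solve-∀

k<2^[1+log₂k] : ∀ k → k < 2 ^ suc ⌊log₂ k ⌋
k<2^[1+log₂k] k = ≰⇒> λ le → 1+n≰n (≤-trans (≤-reflexive (sym (⌊log₂[2^n]⌋≡n (suc ⌊log₂ k ⌋)))) (⌊log₂⌋-mono-≤ le))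

log₂-pos : ∀ {k} → 2 ≤ k → 1 ≤ ⌊log₂ k ⌋
log₂-pos 2≤k = ⌊log₂⌋-mono-≤ 2≤k

m<[1+m/n]*n : ∀ m n .{{_ : NonZero n}} → m < suc (m / n) * n
m<[1+m/n]*n m n = begin-strict
  m                   ≡⟨ m≡m%n+[m/n]*n m n ⟩
  m % n + m / n * n <⟨ +-monoˡ-< (m / n * n) (m%n<n m n) ⟩
  suc (m / n) * n     ∎
  where open ≤-Reasoning

-- The parameters for given k and n, and the resulting error

module Bounds (D n : ℕ) (k+3≤n : 2 + D + 3 ≤ n) where

  k ℓ L M : ℕ
  k = 2 + D
  ℓ = ⌊log₂ k ⌋
  -- Chosen so that `2 ^ L = 8 * 2 ^ suc ℓ` exceeds `8 * k`, which dominates `4 * b` for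
  -- `b = 2 * suc r`.
  L = 4 + ℓ
  M = D / 14

  k≤16[1+M] : k ≤ 16 * suc M
  k≤16[1+M] = begin
    2 + D                  ≤⟨ +-monoʳ-≤ 2 (<⇒≤ (m<[1+m/n]*n D 14)) ⟩
    2 + suc M * 14         ≤⟨ +-monoˡ-≤ (suc M * 14) (m≤m+n 2 (2 * M)) ⟩
    2 + 2 * M + suc M * 14 ≡⟨ e M ⟩
    16 * suc M             ∎
    where
    open ≤-Reasoning
    e : ∀ m → 2 + 2 * m + suc m * 14 ≡ 16 * suc m
    e = solve-∀

  L≤5ℓ : L ≤ 5 * ℓ
  L≤5ℓ = ≤-trans (+-monoˡ-≤ ℓ (*-monoʳ-≤ 4 (log₂-pos {k} (s≤s (s≤s z≤n))))) (≤-reflexive (+-comm (4 * ℓ) ℓ))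

  n²≤4C : n * n ≤ 4 * (n C 2)
  n²≤4C = begin
    n * n                             ≡⟨ sym (2*nC2+n≡n² n) ⟩
    2 * (n C 2) + n                   ≤⟨ +-monoʳ-≤ (2 * (n C 2)) n≤2C ⟩
    2 * (n C 2) + 2 * (n C 2)         ≡⟨ e (n C 2) ⟩
    4 * (n C 2)                       ∎
    where
    open ≤-Reasoning
    e : ∀ c → 2 * c + 2 * c ≡ 4 * c
    e = solve-∀
    n≤2C : n ≤ 2 * (n C 2)
    n≤2C = +-cancelʳ-≤ n _ _ (begin
      n + n            ≡⟨ cong (n +_) (sym (+-identityʳ n)) ⟩
      2 * n            ≤⟨ *-monoˡ-≤ n (≤-trans (s≤s (s≤s z≤n)) k+3≤n) ⟩
      n * n            ≡⟨ sym (2*nC2+n≡n² n) ⟩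
      2 * (n C 2) + n  ∎)

  -- For such small `k` already `k ≤ 80 * ℓ`, and the error term alone suffices.
  trivial-bound : suc M < L → ∀ s → k * (n C 2) ≤ k * s + 200 * ℓ * (n C 2)
  trivial-bound M<L s = ≤-trans (*-monoˡ-≤ (n C 2) (begin
    k               ≤⟨ k≤16[1+M] ⟩
    16 * suc M      ≤⟨ *-monoʳ-≤ 16 (≤-trans (<⇒≤ M<L) L≤5ℓ) ⟩
    16 * (5 * ℓ)    ≡⟨ sym (*-assoc 16 5 ℓ) ⟩
    80 * ℓ          ≤⟨ *-monoˡ-≤ ℓ (m≤m+n 80 120) ⟩
    200 * ℓ         ∎)) (m≤n+m _ (k * s))
    where open ≤-Reasoning

  module _ (L≤1+M : L ≤ suc M) where

    r t q : ℕ
    -- With this `r`, `suc M` services contain `L` blocks of length `r`, each doubling the weight;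
    -- `t` then slightly exceeds `n / (r+1)`, of order `n log k / k`.
    r = suc M / L
    t = suc (n / suc r)
    q = n ∸ t

    r>0 : 0 < r
    r>0 = m≥n⇒m/n>0 L≤1+M

    n≤[1+r]t : n ≤ suc r * t
    n≤[1+r]t = ≤-trans (<⇒≤ (m<[1+m/n]*n n (suc r))) (≤-reflexive (*-comm t (suc r)))

    -- As `suc r` is at least 2, `2 * t ≤ n + 2`; so `n ≤ t` would force `n ≤ 2`. This makes `q`
    -- positive.
    t<n : t < n
    t<n = ≰⇒> λ n≤t → <⇒≱ (≤-trans (m≤n+m 3 k) k+3≤n) (+-cancelˡ-≤ n _ _ (begin
      n + n                   ≡⟨ cong (n +_) (sym (+-identityʳ n)) ⟩
      2 * n                   ≤⟨ *-monoʳ-≤ 2 n≤t ⟩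
      2 * suc (n / suc r)     ≡⟨ e (n / suc r) ⟩
      n / suc r * 2 + 2       ≤⟨ +-monoˡ-≤ 2 (*-monoʳ-≤ (n / suc r) (s≤s r>0)) ⟩
      n / suc r * suc r + 2   ≤⟨ +-monoˡ-≤ 2 (m/n*n≤m n (suc r)) ⟩
      n + 2                   ∎))
      where
      open ≤-Reasoning
      e : ∀ x → 2 * suc x ≡ x * 2 + 2
      e = solve-∀

    t+q≡n : t + q ≡ n
    t+q≡n = m+[n∸m]≡n (<⇒≤ t<n)

    1+r≤k : suc r ≤ k
    1+r≤k = s≤s (≤-trans (m/n≤m (suc M) L) (s≤s (m/n≤m D 14)))

    power : ∀ a → M < a → 4 * (2 * suc r * q ^ a) ≤ n ^ a
    power a M<a = begin
      4 * (2 * suc r * q ^ a)    ≡⟨ e (suc r) (q ^ a) ⟩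
      8 * suc r * q ^ a          ≤⟨ *-monoˡ-≤ (q ^ a) (*-monoʳ-≤ 8 (≤-trans 1+r≤k (<⇒≤ (k<2^[1+log₂k] k)))) ⟩
      8 * 2 ^ suc ℓ * q ^ a      ≡⟨ cong (_* q ^ a) (sym (^-distribˡ-+-* 2 3 (suc ℓ))) ⟩
      2 ^ (3 + suc ℓ) * q ^ a    ≡⟨ cong (λ x → 2 ^ x * q ^ a) (+-suc 3 ℓ) ⟩
      2 ^ L * q ^ a              ≤⟨ shrink-power r n t q L a r>0 t+q≡n n≤[1+r]t (≤-trans (m/n*n≤m (suc M) L) M<a) ⟩
      n ^ a                      ∎
      where
      open ≤-Reasoning
      e : ∀ x y → 4 * (2 * x * y) ≡ 8 * x * y
      e = solve-∀

    -- The three losses are `80 * ℓ * n` from `n / suc r`, via `k ≤ 16 * suc M` and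
    -- `suc M < suc r * L`; then `k ≤ ℓ * n` from rounding `t` up; and `16 * ℓ * n` from at most
    -- `n / suc M` unserved vertices. Their sum, 97, is rounded to 100, and `n * n ≤ 4 * (n C 2)`
    -- leads to the constant 200.
    error : ∀ x → 5 ^ D * x ≤ n * (4 ^ D * 4 ^ M) → k * (n * (t + x)) ≤ 2 * (200 * ℓ * (n C 2))
    error x few = begin
      k * (n * (t + x))                   ≡⟨ e₁ k n (n / suc r) x ⟩
      n * (k * (n / suc r) + k + k * x)   ≤⟨ *-monoʳ-≤ n (+-mono-≤ (+-mono-≤ k[n/r]≤ k≤) kx≤) ⟩
      n * (80 * ℓ * n + ℓ * n + 16 * ℓ * n) ≡⟨ e₂ ℓ n ⟩
      97 * ℓ * (n * n)                    ≤⟨ *-mono-≤ (*-monoˡ-≤ ℓ (m≤m+n 97 3)) n²≤4C ⟩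
      100 * ℓ * (4 * (n C 2))             ≡⟨ e₃ ℓ (n C 2) ⟩
      2 * (200 * ℓ * (n C 2))             ∎
      where
      open ≤-Reasoning
      e₁ : ∀ k n y x → k * (n * (suc y + x)) ≡ n * (k * y + k + k * x)
      e₁ = solve-∀
      e₂ : ∀ ℓ n → n * (80 * ℓ * n + ℓ * n + 16 * ℓ * n) ≡ 97 * ℓ * (n * n)
      e₂ = solve-∀
      e₃ : ∀ ℓ c → 100 * ℓ * (4 * c) ≡ 2 * (200 * ℓ * c)
      e₃ = solve-∀
      ℓ>0 : 1 ≤ ℓ
      ℓ>0 = log₂-pos {k} (s≤s (s≤s z≤n))
      k≤ : k ≤ ℓ * n
      k≤ = ≤-trans (≤-trans (m≤m+n k 3) k+3≤n) (≤-trans (≤-reflexive (sym (*-identityˡ n))) (*-monoˡ-≤ n ℓ>0))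
      k[n/r]≤ : k * (n / suc r) ≤ 80 * ℓ * n
      k[n/r]≤ = begin
        k * (n / suc r)                       ≤⟨ *-monoˡ-≤ (n / suc r) k≤16[1+M] ⟩
        16 * suc M * (n / suc r)              ≤⟨ *-monoˡ-≤ (n / suc r) (*-monoʳ-≤ 16 (<⇒≤ (m<[1+m/n]*n (suc M) L))) ⟩
        16 * (suc r * L) * (n / suc r)        ≤⟨ *-monoˡ-≤ (n / suc r) (*-monoʳ-≤ 16 (*-monoʳ-≤ (suc r) L≤5ℓ)) ⟩
        16 * (suc r * (5 * ℓ)) * (n / suc r)  ≡⟨ e (suc r) ℓ (n / suc r) ⟩
        80 * ℓ * (n / suc r * suc r)          ≤⟨ *-monoʳ-≤ (80 * ℓ) (m/n*n≤m n (suc r)) ⟩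
        80 * ℓ * n                            ∎
        where
        e : ∀ r ℓ y → 16 * (r * (5 * ℓ)) * y ≡ 80 * ℓ * (y * r)
        e = solve-∀
      w = 4 ^ D * 4 ^ M
      [1+M]x≤n : suc M * x ≤ n
      [1+M]x≤n = *-cancelʳ-≤ _ _ w {{m*n≢0 _ _ {{m^n≢0 4 D}} {{m^n≢0 4 M}}}} (begin
        suc M * x * w       ≡⟨ xy∙z≈xz∙y (suc M) x w ⟩
        suc M * w * x       ≤⟨ *-monoˡ-≤ x (few-unserved D M (m/n*n≤m D 14)) ⟩
        5 ^ D * x           ≤⟨ few ⟩
        n * w               ∎)
      kx≤ : k * x ≤ 16 * ℓ * n
      kx≤ = begin
        k * x              ≤⟨ *-monoˡ-≤ x k≤16[1+M] ⟩
        16 * suc M * x     ≡⟨ *-assoc 16 (suc M) x ⟩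
        16 * (suc M * x)   ≤⟨ *-mono-≤ (*-monoʳ-≤ 16 ℓ>0) [1+M]x≤n ⟩
        16 * ℓ * n         ∎

  score-bound : ∀ first → k * (n C 2) ≤ k * score n k first + 200 * ℓ * (n C 2)
  score-bound first with L ≤? suc M
  ... | no L≰1+M  = trivial-bound (≰⇒> L≰1+M) (score n k first)
  ... | yes L≤1+M = Strategy.enough-score n D M (2 * suc (r L≤1+M)) (q L≤1+M) (t L≤1+M) (200 * ℓ * (n C 2))
      (≤-trans (m≤m+n k 3) k+3≤n) (s≤s z≤n) (m<n⇒0<n∸m (t<n L≤1+M)) (s≤s z≤n)
      (≤-reflexive (sym (t+q≡n L≤1+M)))
      ([1+1/2r]^n≤2^t (suc (r L≤1+M)) n (t L≤1+M) (n≤[1+r]t L≤1+M))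
      (power L≤1+M) (error L≤1+M) first

-- The inequality is multiplied by `k`. Since `⌊log₂ k ⌋` is at most `log k / log 2`, it gives the
-- bound with natural logarithm and `C = 200 / log 2`. For `k = 1` no edge is legal while
-- `log 1 = 0`, so the range starts at 2.
theorem1p5 : ∃[ K ] ∀ (k : ℕ) → 2 ≤ k → ∃[ n₀ ] ∀ (n : ℕ) → n₀ ≤ n → ∀ (first : Player) →
    k * (n C 2) ≤ k * score n k first + K * ⌊log₂ k ⌋ * (n C 2)
theorem1p5 = 200 , λ { (suc (suc D)) (s≤s (s≤s z≤n)) → 2 + D + 3 , λ n n₀≤n → Bounds.score-bound D n n₀≤n }
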